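{- Let $n\ge 2$ and $1 \leq a_1 \leq \cdots \leq a_n$ be integers, and let $e = \#E(K_{a_1, \ldots, a_{n-1}})$ be the number of edges of the complete multipartite graph $K_{a_1,\ldots,a_{n-1}}$. If $a_1 + \cdots + a_{n-1} > 6$ and $a_n \geq e$, then \[ \left|\mathcal{F}(K_{a_1, \ldots, a_n})\right| = \left|\mathcal{F}(K_{a_1, \ldots, a_{n-1}, e})\right|. \]
   Context: All graphs are finite, undirected and simple, and are considered up to isomorphism. $K_{a_1,\ldots,a_n}$ denotes the complete multipartite graph whose vertex set is partitioned into parts of sizes $a_1,\ldots,a_n$, with two vertices adjacent iff they lie in different parts. A Triangle-Y ($\nabla Y$) move on a graph $G$ takes a 3-cycle with vertices $a,b,c$, deletes the three edges $ab,bc,ca$, and adds a new vertex $v$ together with the edges $av,bv,cv$. A Y-Triangle ($Y\nabla$) move is the inverse operation: for a vertex $v$ of degree three whose neighbours $a,b,c$ are pairwise non-adjacent, delete $v$ (and its edges) and add the edges $ab,bc,ca$. Two graphs are cousins if one is obtained from the other by a sequence of zero or more $\nabla Y$ and $Y\nabla$ moves. The family $\mathcal{F}(G)$ of $G$ is the set of (isomorphism classes of) cousins of $G$, and $|\mathcal{F}(G)|$ is its family size. -}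

module Defs where

open import Data.Nat using (ℕ; zero; suc; _+_; _*_; _∸_; _≤_; _<_; _<ᵇ_; _≡ᵇ_)
open import Data.Bool using (Bool; true; false; _∧_; _∨_; not; if_then_else_)
open import Data.Bool.Properties using (∧-comm)
open import Data.Fin using (Fin; zero; suc; toℕ; _≟_)
open import Data.Fin.Properties using (toℕ-injective)
open import Data.Nat.ListAction using (sum)
open import Data.List using (List; []; _∷_; length; map; filter; _++_; [_])
open import Data.List.Base using (concatMap; allFin)
open import Data.List.Membership.Propositional using (_∈_)
open import Data.List.Relation.Unary.Any using (Any)
open import Data.List.Relation.Unary.AllPairs using (AllPairs)
open import Data.Product using (Σ; ∃; _×_; _,_; proj₁; proj₂)
open import Data.Sum using (_⊎_)
open import Relation.Nullary using (¬_)
open import Relation.Nullary.Decidable using (⌊_⌋)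
open import Relation.Binary.PropositionalEquality using (_≡_; refl; sym; cong)
open import Relation.Binary.Construct.Closure.ReflexiveTransitive using (Star)
open import Function.Bundles using (_↔_; Inverse)

record GraphOn (k : ℕ) : Set where
  field
    adj    : Fin k → Fin k → Bool
    adj-sym : ∀ x y → adj x y ≡ adj y x
    adj-irr : ∀ x → adj x x ≡ false
open GraphOn public using (adj)

Graph : Set
Graph = Σ ℕ GraphOn

_≅_ : Graph → Graph → Set
(k , G) ≅ (l , H) =
  Σ (Fin k ↔ Fin l) λ φ → ∀ x y → adj G x y ≡ adj H (Inverse.to φ x) (Inverse.to φ y)

numEdges : Graph → ℕ
numEdges (k , G) =
  length (filter (λ p → proj₁ p Data.Fin.<? proj₂ p)
    (filter (λ p → Data.Bool._≟_ (adj G (proj₁ p) (proj₂ p)) true)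
      (concatMap (λ x → map (λ y → (x , y)) (allFin k)) (allFin k))))

-- Complete multipartite graph K_{a_1,...,a_n}: vertices 0 .. (Σ aᵢ - 1),
-- the first a_1 forming part 0, the next a_2 part 1, etc.

partOf : List ℕ → ℕ → ℕ
partOf []       i = 0
partOf (a ∷ as) i = if i <ᵇ a then 0 else suc (partOf as (i ∸ a))

private
  ≡ᵇ-sym : ∀ m n → (m ≡ᵇ n) ≡ (n ≡ᵇ m)
  ≡ᵇ-sym zero    zero    = refl
  ≡ᵇ-sym zero    (suc n) = refl
  ≡ᵇ-sym (suc m) zero    = refl
  ≡ᵇ-sym (suc m) (suc n) = ≡ᵇ-sym m n

  ≡ᵇ-refl : ∀ m → (m ≡ᵇ m) ≡ true
  ≡ᵇ-refl zero    = refl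
  ≡ᵇ-refl (suc m) = ≡ᵇ-refl m

KOn : (as : List ℕ) → GraphOn (sum as)
KOn as = record
  { adj    = λ x y → not (partOf as (toℕ x) ≡ᵇ partOf as (toℕ y))
  ; adj-sym = λ x y → cong not (≡ᵇ-sym (partOf as (toℕ x)) (partOf as (toℕ y)))
  ; adj-irr = λ x → cong not (≡ᵇ-refl (partOf as (toℕ x)))
  }

K : List ℕ → Graph
K as = sum as , KOn as

inT : ∀ {k} → Fin k → Fin k → Fin k → Fin k → Bool
inT a b c x = ⌊ x ≟ a ⌋ ∨ ⌊ x ≟ b ⌋ ∨ ⌊ x ≟ c ⌋

-- ∇Y on the triangle a b c: new vertex is 'zero', old vertex x is 'suc x';
-- the edges ab, bc, ca are deleted, the edges v a, v b, v c added.
ΔYadj : ∀ {k} → GraphOn k → (a b c : Fin k) → Fin (suc k) → Fin (suc k) → Bool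
ΔYadj G a b c zero    zero    = false
ΔYadj G a b c zero    (suc y) = inT a b c y
ΔYadj G a b c (suc x) zero    = inT a b c x
ΔYadj G a b c (suc x) (suc y) = adj G x y ∧ not (inT a b c x ∧ inT a b c y)

ΔYsym : ∀ {k} (G : GraphOn k) a b c x y → ΔYadj G a b c x y ≡ ΔYadj G a b c y x
ΔYsym G a b c zero    zero    = refl
ΔYsym G a b c zero    (suc y) = refl
ΔYsym G a b c (suc x) zero    = refl
ΔYsym G a b c (suc x) (suc y)
  rewrite GraphOn.adj-sym G x y | ∧-comm (inT a b c x) (inT a b c y) = refl

ΔYirr : ∀ {k} (G : GraphOn k) a b c x → ΔYadj G a b c x x ≡ false
ΔYirr G a b c zero    = refl
ΔYirr G a b c (suc x) rewrite GraphOn.adj-irr G x = refl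

ΔY : ∀ {k} → GraphOn k → (a b c : Fin k) → Graph
ΔY {k} G a b c = suc k , record
  { adj = ΔYadj G a b c ; adj-sym = ΔYsym G a b c ; adj-irr = ΔYirr G a b c }

-- Y∇ at the vertex 'zero' of a graph on Fin (suc k) with neighbours a b c:
-- delete zero, add the edges ab, bc, ca.
YΔadj : ∀ {k} → GraphOn (suc k) → (a b c : Fin k) → Fin k → Fin k → Bool
YΔadj G a b c x y =
  adj G (suc x) (suc y) ∨ ((inT a b c x ∧ inT a b c y) ∧ not ⌊ x ≟ y ⌋)

private
  ≟-sym : ∀ {k} (x y : Fin k) → ⌊ x ≟ y ⌋ ≡ ⌊ y ≟ x ⌋
  ≟-sym x y with x ≟ y | y ≟ x
  ... | Relation.Nullary.yes _ | Relation.Nullary.yes _ = refl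
  ... | Relation.Nullary.no _  | Relation.Nullary.no _  = refl
  ... | Relation.Nullary.yes p | Relation.Nullary.no q  = Data.Empty.⊥-elim (q (sym p))
    where import Data.Empty
  ... | Relation.Nullary.no p  | Relation.Nullary.yes q = Data.Empty.⊥-elim (p (sym q))
    where import Data.Empty

  ≟-refl : ∀ {k} (x : Fin k) → ⌊ x ≟ x ⌋ ≡ true
  ≟-refl x with x ≟ x
  ... | Relation.Nullary.yes _ = refl
  ... | Relation.Nullary.no p  = Data.Empty.⊥-elim (p refl)
    where import Data.Empty

YΔsym : ∀ {k} (G : GraphOn (suc k)) a b c x y → YΔadj G a b c x y ≡ YΔadj G a b c y x
YΔsym G a b c x y =
  Relation.Binary.PropositionalEquality.cong₂ _∨_ (GraphOn.adj-sym G (suc x) (suc y))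
    (Relation.Binary.PropositionalEquality.cong₂ _∧_ (∧-comm (inT a b c x) (inT a b c y))
      (cong not (≟-sym x y)))

YΔirr : ∀ {k} (G : GraphOn (suc k)) a b c x → YΔadj G a b c x x ≡ false
YΔirr G a b c x rewrite GraphOn.adj-irr G (suc x) | ≟-refl x
  = Data.Bool.Properties.∧-zeroʳ (inT a b c x ∧ inT a b c x)
  where import Data.Bool.Properties

YΔ : ∀ {k} → GraphOn (suc k) → (a b c : Fin k) → Graph
YΔ {k} G a b c = k , record
  { adj = YΔadj G a b c ; adj-sym = YΔsym G a b c ; adj-irr = YΔirr G a b c }

Distinct3 : ∀ {k} → Fin k → Fin k → Fin k → Set
Distinct3 a b c = ¬ a ≡ b × ¬ b ≡ c × ¬ a ≡ c

-- One move (∇Y or Y∇), with results taken up to isomorphism.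
-- A Y∇ move at an arbitrary vertex v of G is expressed by relabelling G
-- (via an isomorphism G' ≅ G) so that v becomes 'zero'.
data Move : Graph → Graph → Set where
  ∇Y-move : ∀ {k} (G : GraphOn k) (a b c : Fin k) (H : Graph) →
            Distinct3 a b c →
            adj G a b ≡ true → adj G b c ≡ true → adj G c a ≡ true →
            ΔY G a b c ≅ H → Move (k , G) H
  Y∇-move : ∀ {k} (G' : GraphOn (suc k)) (G : Graph) (a b c : Fin k) (H : Graph) →
            (suc k , G') ≅ G →
            Distinct3 a b c →
            (∀ x → adj G' zero (suc x) ≡ inT a b c x) →
            adj G' (suc a) (suc b) ≡ false → adj G' (suc b) (suc c) ≡ false →
            adj G' (suc c) (suc a) ≡ false →
            YΔ G' a b c ≅ H → Move G H

Cousin : Graph → Graph → Set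
Cousin G H = Σ Graph λ H' → Star Move G H' × H' ≅ H

HasFamilySize : Graph → ℕ → Set
HasFamilySize G m =
  Σ (List Graph) λ L →
    length L ≡ m ×
    AllPairs (λ X Y → ¬ X ≅ Y) L ×
    Data.List.Relation.Unary.All.All (Cousin G) L ×
    (∀ H → Cousin G H → Any (λ X → H ≅ X) L)
  where import Data.List.Relation.Unary.All

{-# OPTIONS --safe #-}
module Submission where

-- Let B = K_{a_1,…,a_{n-1}} have N > 6 vertices and e edges, and let J_c be the join of B with an
-- independent set W of c vertices, where c is e or a_n.  Every vertex of J_c has degree 0 or at
-- least 7.  Replacing edge-disjoint triangles by Y's at most halves the degrees, so an original
-- vertex never gets degree 3, and a Y∇ move always undoes an earlier ∇Y move.  Hence the cousins
-- of J_c are the graphs obtained from a packing of edge-disjoint triangles, and two of them are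
-- isomorphic iff an automorphism of J_c carries one packing to the other.
--
-- Each triangle of a packing owns an edge of B, so at most e vertices of W are involved and every
-- packing can be moved into J_e.  An automorphism of J_c preserving W acts on packings in J_e in a
-- way that does not depend on c.  If an automorphism does not preserve W, then either B has no
-- edges and there are no triangles, or B has a part with c ≥ e vertices, which forces B to be a
-- star; there two packings of the same size are always equivalent.

open import Defs
open import Data.Nat using (ℕ; zero; suc; _+_; _≤_; _<_; _>_; _∸_; _<ᵇ_; _≡ᵇ_; s≤s; z≤n)
open import Data.Nat.ListAction using (sum)
open import Data.Nat.ListAction.Properties using (sum-++)
open import Data.List using (List; []; _∷_; length; _++_; [_])
open import Data.List.Base using (allFin; concatMap; filter; map; lookup)
open import Data.List.Relation.Unary.All using (All; []; _∷_)
open import Data.List.Relation.Unary.Linked using (Linked; _∷_)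
open import Function.Bundles using (_⇔_; _↔_; Inverse; mk⇔; mk↔ₛ′; Equivalence)
open import Data.Bool using (Bool; true; false; _∧_; not)
open import Data.Bool.Properties using (⇔→≡; T-≡; not-injective; ¬-not; ∧-conicalˡ; ∧-conicalʳ)
open import Data.Empty using (⊥; ⊥-elim)
open import Data.Fin using (Fin; zero; suc; _≟_; _<?_; inject≤; toℕ; fromℕ<; combine; punchIn; punchOut)
open import Data.Fin.Properties using (any?; suc-injective; +↔⊎; toℕ<n; toℕ-cast; toℕ-fromℕ<; toℕ-↑ˡ; toℕ-↑ʳ; combine-injective; punchIn-punchOut; punchOut-injective; <⇒notInjective; injective⇒≤; inject≤-injective; <-cmp)
open import Data.Nat.Properties using (n<1+n; +-identityʳ; +-assoc; ≡ᵇ⇒≡; ≡⇒≡ᵇ; <ᵇ⇒<; <⇒<ᵇ; ≮⇒≥; <-irrefl; m+n∸m≡n; m+n≮m; m<m+n; ∸-monoˡ-<; ≤-trans; ≤-refl; 1+n≰n)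
open import Data.Nat.Base using (s≤s⁻¹)
open import Data.Fin.Permutation using (Permutation′; transpose; cast-id)
open import Data.Fin.Permutation.Components using () renaming (transpose to swap)
open import Data.List.Membership.Propositional using (_∈_)
open import Data.List.Membership.Propositional.Properties using (∈-allFin; ∈-filter⁺; ∈-filter⁻; ∈-concatMap⁺; ∈-map⁺; ∈-lookup)
open import Data.List.Relation.Binary.Pointwise using (Pointwise; []; _∷_)
open import Data.List.Relation.Unary.AllPairs using (AllPairs; []; _∷_)
open import Data.List.Relation.Unary.Any using (Any; here; there) renaming (map to Any-map; index to Any-index)
open import Data.List.Relation.Unary.Any.Properties using (lookup-index)
open import Data.Maybe using (Maybe; just; nothing)
open import Data.Maybe.Properties using (just-injective) renaming (≡-dec to Maybe-≡-dec)
open import Data.Product using (Σ; ∃; ∃₂; _×_; _,_; proj₁; proj₂)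
open import Data.Sum using (_⊎_; inj₁; inj₂; map₁; map₂)
open import Data.Sum.Properties using (inj₁-injective; inj₂-injective) renaming (≡-dec to ⊎-≡-dec)
open import Data.Sum.Function.Propositional using (_⊎-↔_)
open import Data.Vec.Functional using () renaming (_∷_ to _◂_; [] to ⟨⟩)
open import Function using (_∘_)
open import Function.Definitions using (Injective)
open import Function.Properties.Inverse using (↔-refl; ↔-sym; ↔-trans)
open import Relation.Binary.Definitions using (DecidableEquality; tri<; tri≈; tri>)
open import Relation.Binary.Construct.Closure.ReflexiveTransitive using (Star; ε; _◅_; _◅◅_)
open import Relation.Binary.PropositionalEquality using (_≡_; _≢_; refl; sym; trans; cong; cong₂; subst; subst₂; ≢-sym)
open import Relation.Nullary using (¬_; Dec; yes; no; contradiction)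
open import Relation.Nullary.Decidable using (⌊_⌋; ¬?; _×-dec_; _⊎-dec_; dec-true; dec-false)

open Inverse using (to; from; strictlyInverseˡ; strictlyInverseʳ)

private variable
  k l m n : ℕ
  A C : Set

-- Bijections and permutations

to-injective : (φ : A ↔ C) → ∀ {x y} → to φ x ≡ to φ y → x ≡ y
to-injective φ {x} {y} eq =
  trans (sym (strictlyInverseʳ φ x)) (trans (cong (from φ) eq) (strictlyInverseʳ φ y))

to≡⇒from≡ : (φ : A ↔ C) → ∀ {x y} → to φ x ≡ y → from φ y ≡ x
to≡⇒from≡ φ {x} refl = strictlyInverseʳ φ x

from≡⇒to≡ : (φ : A ↔ C) → ∀ {x y} → from φ y ≡ x → to φ x ≡ y
from≡⇒to≡ φ = to≡⇒from≡ (↔-sym φ)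

-- The inverse stays on its side too: a preimage in the wrong summand would have its image in that
-- summand.
split-↔ : {A₁ A₂ C₁ C₂ : Set} (φ : (A₁ ⊎ A₂) ↔ (C₁ ⊎ C₂)) →
          (∀ x → ∃ λ y → to φ (inj₁ x) ≡ inj₁ y) →
          (∀ x → ∃ λ y → to φ (inj₂ x) ≡ inj₂ y) →
          Σ (A₁ ↔ C₁) λ φ₁ → Σ (A₂ ↔ C₂) λ φ₂ →
            (∀ x → to φ (inj₁ x) ≡ inj₁ (to φ₁ x)) × (∀ x → to φ (inj₂ x) ≡ inj₂ (to φ₂ x))
split-↔ {A₁} {A₂} {C₁} {C₂} φ f g =
    mk↔ₛ′ (proj₁ ∘ f) (proj₁ ∘ f′)
      (λ y → inj₁-injective (trans (sym (proj₂ (f _))) (from≡⇒to≡ φ (proj₂ (f′ y)))))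
      (λ x → inj₁-injective (trans (sym (proj₂ (f′ _))) (to≡⇒from≡ φ (proj₂ (f x)))))
  , mk↔ₛ′ (proj₁ ∘ g) (proj₁ ∘ g′)
      (λ y → inj₂-injective (trans (sym (proj₂ (g _))) (from≡⇒to≡ φ (proj₂ (g′ y)))))
      (λ x → inj₂-injective (trans (sym (proj₂ (g′ _))) (to≡⇒from≡ φ (proj₂ (g x)))))
  , proj₂ ∘ f , proj₂ ∘ g
  where
  f′ : ∀ y → ∃ λ x → from φ (inj₁ y) ≡ inj₁ x
  f′ y with from φ (inj₁ y) in eq
  ... | inj₁ x = x , refl
  ... | inj₂ x with () ← trans (sym (from≡⇒to≡ φ eq)) (proj₂ (g x))
  g′ : ∀ y → ∃ λ x → from φ (inj₂ y) ≡ inj₂ x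
  g′ y with from φ (inj₂ y) in eq
  ... | inj₂ x = x , refl
  ... | inj₁ x with () ← trans (sym (from≡⇒to≡ φ eq)) (proj₂ (f x))

swap-left : (i j : Fin n) → swap i j i ≡ j
swap-left i j rewrite dec-true (i ≟ i) refl = refl

swap-other : {i j x : Fin n} → x ≢ i → x ≢ j → swap i j x ≡ x
swap-other {i = i} {j} {x} x≢i x≢j rewrite dec-false (x ≟ i) x≢i | dec-false (x ≟ j) x≢j = refl

-- Extends a finite partial injection point by point: when `x` must go to `y`, compose with the
-- transposition of its present image and `y`. Related points treated earlier keep their images,
-- which differ from that of `x`, and from `y` by injectivity of `R`.
extend-to-permutation :
  (R : Fin n → Fin n → Set) → (∀ x y → Dec (R x y)) →
  (∀ {x y y′} → R x y → R x y′ → y ≡ y′) →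
  (∀ {x x′ y} → R x y → R x′ y → x ≡ x′) →
  Σ (Permutation′ n) λ π → ∀ {x y} → R x y → to π x ≡ y
extend-to-permutation {n} R R? functional injective =
  proj₁ (on (allFin n)) , proj₂ (on (allFin n)) (∈-allFin _)
  where
  on : (xs : List (Fin n)) → Σ (Permutation′ n) λ π → ∀ {x y} → x ∈ xs → R x y → to π x ≡ y
  on [] = ↔-refl , λ ()
  on (x ∷ xs) with on xs | any? (R? x)
  ... | π , agrees | no none = π , λ where
    (here refl) r → contradiction (_ , r) none
    (there z∈)  r → agrees z∈ r
  ... | π , agrees | yes (y , Rxy) = ↔-trans π (transpose (to π x) y) , agrees′
    where
    at-x : swap (to π x) y (to π x) ≡ y
    at-x = swap-left (to π x) y
    agrees′ : ∀ {z w} → z ∈ x ∷ xs → R z w → swap (to π x) y (to π z) ≡ w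
    agrees′ (here refl) r = trans at-x (functional Rxy r)
    agrees′ {z} {w} (there z∈) r with z ≟ x
    ... | yes refl = trans at-x (functional Rxy r)
    ... | no z≢x = trans (swap-other (z≢x ∘ to-injective π) πz≢y) (agrees z∈ r)
      where
      πz≢y : to π z ≢ y
      πz≢y eq = z≢x (injective (subst (R z) (trans (sym (agrees z∈ r)) eq) r) Rxy)

-- Isomorphic graphs and transfer of family sizes

≅-refl : ∀ G → G ≅ G
≅-refl _ = ↔-refl , λ _ _ → refl

≅-sym : ∀ G H → G ≅ H → H ≅ G
≅-sym (_ , G) (_ , H) (φ , eq) = ↔-sym φ , λ x y → sym (trans (eq (from φ x) (from φ y))
  (cong₂ (adj H) (strictlyInverseˡ φ x) (strictlyInverseˡ φ y)))

-- A list of representatives is replaced entry by entry by `R`-related cousins. Here `iso` keeps the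
-- new list exhaustive, and `iso′` keeps its entries pairwise non-isomorphic.
transfer-family-size :
  {G G′ : Graph} (R : Graph → Graph → Set) →
  (∀ H → Cousin G H → ∃ λ H′ → Cousin G′ H′ × R H H′) →
  (∀ H′ → Cousin G′ H′ → ∃ λ H → Cousin G H × R H H′) →
  (∀ {H H′ X X′} → R H H′ → R X X′ → H ≅ X → H′ ≅ X′) →
  (∀ {H H′ X X′} → R H H′ → R X X′ → H′ ≅ X′ → H ≅ X) →
  ∀ {m} → HasFamilySize G m → HasFamilySize G′ m
transfer-family-size {G} {G′} R total total′ iso iso′ (L , len , distinct , cousins , covers) =
  let L′ , RLL′ , cousins′ = images L cousins in
  L′ , trans (sym (same-length RLL′)) len , distinct′ RLL′ distinct , cousins′ , λ H′ c′ →
    let H , c , r = total′ H′ c′ in covers′ r RLL′ (covers H c)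
  where
  images : ∀ L → All (Cousin G) L → ∃ λ L′ → Pointwise R L L′ × All (Cousin G′) L′
  images [] [] = [] , [] , []
  images (H ∷ L) (c ∷ cs) =
    let H′ , c′ , r = total H c ; L′ , rs , cs′ = images L cs in H′ ∷ L′ , r ∷ rs , c′ ∷ cs′
  same-length : ∀ {L L′} → Pointwise R L L′ → length L ≡ length L′
  same-length [] = refl
  same-length (_ ∷ rs) = cong suc (same-length rs)
  apart : ∀ {H H′ L L′} → R H H′ → Pointwise R L L′ →
          All (λ X → ¬ H ≅ X) L → All (λ X → ¬ H′ ≅ X) L′
  apart r [] [] = []
  apart r (s ∷ rs) (p ∷ ps) = p ∘ iso′ r s ∷ apart r rs ps
  distinct′ : ∀ {L L′} → Pointwise R L L′ →
              AllPairs (λ X Y → ¬ X ≅ Y) L → AllPairs (λ X Y → ¬ X ≅ Y) L′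
  distinct′ [] [] = []
  distinct′ (r ∷ rs) (p ∷ ps) = apart r rs p ∷ distinct′ rs ps
  covers′ : ∀ {H H′ L L′} → R H H′ → Pointwise R L L′ → Any (H ≅_) L → Any (H′ ≅_) L′
  covers′ r (s ∷ rs) (here p)  = here (iso r s p)
  covers′ r (s ∷ rs) (there p) = there (covers′ r rs p)

-- Triangles replaced by Y's

Triple : Set → Set
Triple A = Fin 3 → A

_∈ᵗ_ : A → Triple A → Set
x ∈ᵗ t = ∃ λ j → t j ≡ x

triple : A → A → A → Triple A
triple a b c = a ◂ b ◂ c ◂ ⟨⟩

∈ᵗ-map : (f : A → C) {t : Triple A} {x : A} → x ∈ᵗ t → f x ∈ᵗ (f ∘ t)
∈ᵗ-map f (j , eq) = j , cong f eq

inT⇒∈ᵗ : (a b c x : Fin n) → inT a b c x ≡ true → x ∈ᵗ triple a b c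
inT⇒∈ᵗ a b c x p with x ≟ a | x ≟ b | x ≟ c
... | yes eq | _ | _ = zero , sym eq
... | no _ | yes eq | _ = suc zero , sym eq
... | no _ | no _ | yes eq = suc (suc zero) , sym eq

∈ᵗ⇒inT : (a b c x : Fin n) → x ∈ᵗ triple a b c → inT a b c x ≡ true
∈ᵗ⇒inT a b c x (j , eq) with x ≟ a | x ≟ b | x ≟ c
... | yes _ | _ | _ = refl
... | no _ | yes _ | _ = refl
... | no _ | no _ | yes _ = refl
∈ᵗ⇒inT a b c x (zero , eq)           | no x≢a | no _ | no _ = contradiction (sym eq) x≢a
∈ᵗ⇒inT a b c x (suc zero , eq)       | no _ | no x≢b | no _ = contradiction (sym eq) x≢b
∈ᵗ⇒inT a b c x (suc (suc zero) , eq) | no _ | no _ | no x≢c = contradiction (sym eq) x≢c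

record Base : Set₁ where
  field
    V        : Set
    _≟ᵛ_     : DecidableEquality V
    edge     : V → V → Bool
    edge-irr : ∀ x → edge x x ≡ false

module Resolve (base : Base) where
  open Base base

  Triangles : ℕ → Set
  Triangles k = Fin k → Triple V

  _∈?_ : (x : V) (t : Triple V) → Dec (x ∈ᵗ t)
  x ∈? t = any? (λ j → t j ≟ᵛ x)

  edge⇒≢ : ∀ {x y} → edge x y ≡ true → x ≢ y
  edge⇒≢ {x} xy refl with () ← trans (sym xy) (edge-irr x)

  Covers : Triangles k → V → V → Set
  Covers T x y = ∃ λ i → x ∈ᵗ T i × y ∈ᵗ T i

  covers? : (T : Triangles k) (x y : V) → Dec (Covers T x y)
  covers? T x y = any? (λ i → (x ∈? T i) ×-dec (y ∈? T i))

  -- The base graph with the triangle T i replaced by a Y centred at inj₁ i, for every i.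
  Adj : Triangles k → Fin k ⊎ V → Fin k ⊎ V → Set
  Adj T (inj₁ i) (inj₁ j) = ⊥
  Adj T (inj₁ i) (inj₂ y) = y ∈ᵗ T i
  Adj T (inj₂ x) (inj₁ j) = x ∈ᵗ T j
  Adj T (inj₂ x) (inj₂ y) = edge x y ≡ true × ¬ Covers T x y

  -- Edge-disjointness is phrased through pairs of distinct common vertices. Since `edge` is
  -- irreflexive, `clique` also makes the three corners distinct.
  record Packing (T : Triangles k) : Set where
    field
      clique   : ∀ i {p q} → p ≢ q → edge (T i p) (T i q) ≡ true
      disjoint : ∀ {i j x y} → x ≢ y → x ∈ᵗ T i → y ∈ᵗ T i → x ∈ᵗ T j → y ∈ᵗ T j → i ≡ j

    ∈⇒edge : ∀ {i x y} → x ∈ᵗ T i → y ∈ᵗ T i → x ≢ y → edge x y ≡ true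
    ∈⇒edge {i} (p , refl) (q , refl) x≢y = clique i λ { refl → x≢y refl }

  open Packing

  record Models (T : Triangles k) (H : Graph) : Set where
    field
      vertex : Fin (proj₁ H) ↔ (Fin k ⊎ V)
      adj⇒Adj : ∀ {x y} → adj (proj₂ H) x y ≡ true → Adj T (to vertex x) (to vertex y)
      Adj⇒adj : ∀ {x y} → Adj T (to vertex x) (to vertex y) → adj (proj₂ H) x y ≡ true

  open Models

  Models-≅ : ∀ {T : Triangles k} {H X} → H ≅ X → Models T H → Models T X
  Models-≅ {T = T} {_ , G} {_ , X} (φ , eq) M = record
    { vertex = ↔-trans (↔-sym φ) (vertex M)
    ; adj⇒Adj = λ {x} {y} a → adj⇒Adj M (trans (eq′ x y) a)
    ; Adj⇒adj = λ {x} {y} a → trans (sym (eq′ x y)) (Adj⇒adj M a)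
    }
    where
    eq′ : ∀ x y → adj G (from φ x) (from φ y) ≡ adj X x y
    eq′ x y = trans (eq (from φ x) (from φ y))
                    (cong₂ (adj X) (strictlyInverseˡ φ x) (strictlyInverseˡ φ y))

  Models⇒≅ : ∀ {T : Triangles k} {H X} → Models T H → Models T X → H ≅ X
  Models⇒≅ {T = T} M M′ = ↔-trans (vertex M) (↔-sym (vertex M′)) , λ x y →
    ⇔→≡ {z = true} (mk⇔
      (λ a → Adj⇒adj M′ (subst₂ (Adj T) (sym (strictlyInverseˡ (vertex M′) _))
                                        (sym (strictlyInverseˡ (vertex M′) _)) (adj⇒Adj M a)))
      (λ a → Adj⇒adj M (subst₂ (Adj T) (strictlyInverseˡ (vertex M′) _)
                                       (strictlyInverseˡ (vertex M′) _) (adj⇒Adj M′ a))))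

  -- Equivalence of packings under automorphisms of the base graph; triangles are compared as vertex
  -- sets, whatever the order of their corners.
  record Carry (T : Triangles k) (T′ : Triangles l) : Set where
    field
      index : Fin k ↔ Fin l
      auto  : V ↔ V
      edge≡ : ∀ x y → edge x y ≡ edge (to auto x) (to auto y)
      mem⇒ : ∀ {i x} → x ∈ᵗ T i → to auto x ∈ᵗ T′ (to index i)
      mem⇐ : ∀ {i x} → to auto x ∈ᵗ T′ (to index i) → x ∈ᵗ T i

  Models-carry : ∀ {T : Triangles k} {T′ : Triangles l} {H} → Carry T T′ → Models T H → Models T′ H
  Models-carry {T = T} {T′} carry M = record
    { vertex = ↔-trans (vertex M) (index ⊎-↔ auto)
    ; adj⇒Adj = push _ _ ∘ adj⇒Adj M
    ; Adj⇒adj = Adj⇒adj M ∘ pull _ _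
    }
    where
    open Carry carry
    Θ = index ⊎-↔ auto
    push : ∀ u v → Adj T u v → Adj T′ (to Θ u) (to Θ v)
    push (inj₁ i) (inj₂ y) a = mem⇒ a
    push (inj₂ x) (inj₁ j) a = mem⇒ a
    push (inj₂ x) (inj₂ y) (a , free) = trans (sym (edge≡ x y)) a , λ (i , p , q) →
      free (from index i , mem⇐ (at p) , mem⇐ (at q))
      where
      at : ∀ {i z} → z ∈ᵗ T′ i → z ∈ᵗ T′ (to index (from index i))
      at {i} = subst (λ j → _ ∈ᵗ T′ j) (sym (strictlyInverseˡ index i))
    pull : ∀ u v → Adj T′ (to Θ u) (to Θ v) → Adj T u v
    pull (inj₁ i) (inj₂ y) a = mem⇐ a
    pull (inj₂ x) (inj₁ j) a = mem⇐ a
    pull (inj₂ x) (inj₂ y) (a , free) = trans (edge≡ x y) a , λ (i , p , q) →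
      free (to index i , mem⇒ p , mem⇒ q)

  bump : Fin k ⊎ V → Fin (suc k) ⊎ V
  bump = map₁ suc

  bump-injective : {u v : Fin k ⊎ V} → bump u ≡ bump v → u ≡ v
  bump-injective {u = inj₁ i} {inj₁ j} refl = refl
  bump-injective {u = inj₂ x} {inj₂ y} refl = refl

  unbump : (u : Fin (suc k) ⊎ V) → u ≢ inj₁ zero → ∃ λ v → bump v ≡ u
  unbump (inj₁ zero) ≢0 = contradiction refl ≢0
  unbump (inj₁ (suc i)) _ = inj₁ i , refl
  unbump (inj₂ x) _ = inj₂ x , refl

  _On_ : Fin k ⊎ V → Triple V → Set
  u On t = ∃ λ x → u ≡ inj₂ x × x ∈ᵗ t

  -- Replacing the further triangle `T zero` changes adjacency among the old vertices only for pairs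
  -- of its corners.
  Adj-bump⁺ : ∀ (T : Triangles (suc k)) u v → Adj (T ∘ suc) u v →
              ¬ (u On T zero × v On T zero) → Adj T (bump u) (bump v)
  Adj-bump⁺ T (inj₁ i) (inj₂ y) a _ = a
  Adj-bump⁺ T (inj₂ x) (inj₁ j) a _ = a
  Adj-bump⁺ T (inj₂ x) (inj₂ y) (a , free) off = a , λ where
    (zero , p , q)  → off ((x , refl , p) , (y , refl , q))
    (suc i , p , q) → free (i , p , q)

  Adj-bump⁻ : ∀ (T : Triangles (suc k)) u v → Adj T (bump u) (bump v) →
              Adj (T ∘ suc) u v × ¬ (u On T zero × v On T zero)
  Adj-bump⁻ T (inj₁ i) (inj₂ y) a = a , λ { ((_ , () , _) , _) }
  Adj-bump⁻ T (inj₂ x) (inj₁ j) a = a , λ { (_ , (_ , () , _)) }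
  Adj-bump⁻ T (inj₂ x) (inj₂ y) (a , free) =
    (a , λ (i , p , q) → free (suc i , p , q)) , λ where
      ((_ , refl , p) , (_ , refl , q)) → free (zero , p , q)

  -- The vertex created by the move becomes the Y-centre with index zero, and the earlier centres
  -- shift up by one.
  ΔY-models : ∀ {T : Triangles (suc k)} {G : GraphOn m} {a b c} (M : Models (T ∘ suc) (m , G)) →
              (∀ j → to (vertex M) (triple a b c j) ≡ inj₂ (T zero j)) →
              Models T (ΔY G a b c)
  ΔY-models {k} {m} {T} {G} {a} {b} {c} M hits = record
    { vertex = mk↔ₛ′ to⁺ from⁺ to-from from-to
    ; adj⇒Adj = λ {x} {y} → ⇒ x y
    ; Adj⇒adj = λ {x} {y} → ⇐ x y
    }
    where
    φ = vertex M
    to⁺ : Fin (suc m) → Fin (suc k) ⊎ V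
    to⁺ zero = inj₁ zero
    to⁺ (suc x) = bump (to φ x)
    from⁺ : Fin (suc k) ⊎ V → Fin (suc m)
    from⁺ (inj₁ zero) = zero
    from⁺ (inj₁ (suc i)) = suc (from φ (inj₁ i))
    from⁺ (inj₂ x) = suc (from φ (inj₂ x))
    to-from : ∀ u → to⁺ (from⁺ u) ≡ u
    to-from (inj₁ zero) = refl
    to-from (inj₁ (suc i)) = cong bump (strictlyInverseˡ φ (inj₁ i))
    to-from (inj₂ x) = cong bump (strictlyInverseˡ φ (inj₂ x))
    from-bump : ∀ u → from⁺ (bump u) ≡ suc (from φ u)
    from-bump (inj₁ _) = refl
    from-bump (inj₂ _) = refl
    from-to : ∀ x → from⁺ (to⁺ x) ≡ x
    from-to zero = refl
    from-to (suc x) = trans (from-bump (to φ x)) (cong suc (strictlyInverseʳ φ x))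
    inT⇒On : ∀ {x} → inT a b c x ≡ true → to φ x On T zero
    inT⇒On {x} p with inT⇒∈ᵗ a b c x p
    ... | j , refl = T zero j , hits j , (j , refl)
    On⇒inT : ∀ {x} → to φ x On T zero → inT a b c x ≡ true
    On⇒inT (_ , eq , (j , refl)) = ∈ᵗ⇒inT a b c _ (j , to-injective φ (trans (hits j) (sym eq)))
    Y⇒ : ∀ u → u On T zero → Adj T (inj₁ zero) (bump u) × Adj T (bump u) (inj₁ zero)
    Y⇒ (inj₂ x) (_ , refl , p) = p , p
    Y⇐ : ∀ u → Adj T (inj₁ zero) (bump u) ⊎ Adj T (bump u) (inj₁ zero) → u On T zero
    Y⇐ (inj₁ i) (inj₁ ())
    Y⇐ (inj₁ i) (inj₂ ())
    Y⇐ (inj₂ x) (inj₁ p) = x , refl , p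
    Y⇐ (inj₂ x) (inj₂ p) = x , refl , p
    ⇒ : ∀ x y → ΔYadj G a b c x y ≡ true → Adj T (to⁺ x) (to⁺ y)
    ⇒ zero (suc y) e = proj₁ (Y⇒ _ (inT⇒On e))
    ⇒ (suc x) zero e = proj₂ (Y⇒ _ (inT⇒On e))
    ⇒ (suc x) (suc y) e =
      Adj-bump⁺ T _ _ (adj⇒Adj M (∧-conicalˡ _ _ e)) λ (p , q) →
        contradiction (∧-conicalʳ (adj G x y) _ e) (λ r → not-both (On⇒inT p) (On⇒inT q) r)
      where
      not-both : ∀ {p q} → p ≡ true → q ≡ true → ¬ (not (p ∧ q) ≡ true)
      not-both refl refl ()
    ⇐ : ∀ x y → Adj T (to⁺ x) (to⁺ y) → ΔYadj G a b c x y ≡ true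
    ⇐ zero (suc y) e = On⇒inT (Y⇐ _ (inj₁ e))
    ⇐ (suc x) zero e = On⇒inT (Y⇐ _ (inj₂ e))
    ⇐ (suc x) (suc y) e with Adj-bump⁻ T _ _ e
    ... | a′ , off with adj G x y in xy | inT a b c x in px | inT a b c y in py
    ... | true  | false | _     = refl
    ... | true  | true  | false = refl
    ... | true  | true  | true  = contradiction (inT⇒On px , inT⇒On py) off
    ... | false | _     | _     with () ← trans (sym xy) (Adj⇒adj M a′)

  -- The vertex removed is the centre of the first Y, so the edges added back are those of `T zero`;
  -- by edge-disjointness no remaining triangle covers them.
  YΔ-models : ∀ {T : Triangles (suc k)} {G : GraphOn (suc m)} {a b c} → Packing T →
              (M : Models T (suc m , G)) → to (vertex M) zero ≡ inj₁ zero →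
              (∀ x → adj G zero (suc x) ≡ inT a b c x) →
              Models (T ∘ suc) (YΔ G a b c)
  YΔ-models {k} {m} {T} {G} {a} {b} {c} P M zero↦zero nbrs = record
    { vertex = mk↔ₛ′ to⁻ from⁻
        (λ u → bump-injective (trans (bump-to _) (from≡⇒to≡ φ (sym (suc-from u)))))
        (λ x → suc-injective (trans (suc-from _) (to≡⇒from≡ φ (sym (bump-to x)))))
    ; adj⇒Adj = λ {x} {y} → ⇒ x y
    ; Adj⇒adj = λ {x} {y} → ⇐ x y
    }
    where
    φ = vertex M
    suc↦ : ∀ x → to φ (suc x) ≢ inj₁ zero
    suc↦ x eq with () ← to-injective φ (trans eq (sym zero↦zero))
    to⁻ : Fin m → Fin k ⊎ V
    to⁻ x = proj₁ (unbump _ (suc↦ x))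
    bump-to : ∀ x → bump (to⁻ x) ≡ to φ (suc x)
    bump-to x = proj₂ (unbump _ (suc↦ x))
    pred-from : ∀ u → ∃ λ x → suc x ≡ from φ (bump u)
    pred-from u with from φ (bump u) in eq
    ... | suc x = x , refl
    ... | zero with trans (sym zero↦zero) (from≡⇒to≡ φ eq)
    pred-from (inj₁ _) | zero | ()
    pred-from (inj₂ _) | zero | ()
    from⁻ : Fin k ⊎ V → Fin m
    from⁻ u = proj₁ (pred-from u)
    suc-from : ∀ u → suc (from⁻ u) ≡ from φ (bump u)
    suc-from u = proj₂ (pred-from u)
    adj⇔ : ∀ x y → adj G (suc x) (suc y) ≡ true ⇔ Adj T (bump (to⁻ x)) (bump (to⁻ y))
    adj⇔ x y rewrite bump-to x | bump-to y = mk⇔ (adj⇒Adj M) (Adj⇒adj M)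
    nbr⇔ : ∀ x → inT a b c x ≡ true ⇔ Adj T (inj₁ zero) (bump (to⁻ x))
    nbr⇔ x rewrite bump-to x | sym (nbrs x) = mk⇔
      (subst (λ u → Adj T u (to φ (suc x))) zero↦zero ∘ adj⇒Adj M)
      (Adj⇒adj M ∘ subst (λ u → Adj T u (to φ (suc x))) (sym zero↦zero))
    inT⇒On : ∀ x → inT a b c x ≡ true → to⁻ x On T zero
    inT⇒On x p with to⁻ x | Equivalence.to (nbr⇔ x) p
    ... | inj₂ z | z∈ = z , refl , z∈
    On⇒inT : ∀ x → to⁻ x On T zero → inT a b c x ≡ true
    On⇒inT x (z , eq , z∈) =
      Equivalence.from (nbr⇔ x) (subst (λ u → Adj T (inj₁ zero) (bump u)) (sym eq) z∈)
    to⁻-injective : ∀ {x y} → to⁻ x ≡ to⁻ y → x ≡ y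
    to⁻-injective {x} {y} eq =
      suc-injective (to-injective φ (trans (sym (bump-to x)) (trans (cong bump eq) (bump-to y))))
    ⇒ : ∀ x y → YΔadj G a b c x y ≡ true → Adj (T ∘ suc) (to⁻ x) (to⁻ y)
    ⇒ x y e with adj G (suc x) (suc y) in xy
    ... | true = proj₁ (Adj-bump⁻ T _ _ (Equivalence.to (adj⇔ x y) xy))
    ... | false with inT a b c x in px | inT a b c y in py | x ≟ y
    ... | true | true | no x≢y
      with to⁻ x in ex | to⁻ y in ey | inT⇒On x px | inT⇒On y py
    ... | _ | _ | u , refl , u∈ | v , refl , v∈ =
      ∈⇒edge P u∈ v∈ u≢v , λ (i , p , q) → 0≢suc (disjoint P u≢v u∈ v∈ p q)
      where
      u≢v : u ≢ v
      u≢v refl = x≢y (to⁻-injective (trans ex (sym ey)))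
      0≢suc : ∀ {i : Fin k} → ¬ zero ≡ suc i
      0≢suc ()
    ⇐ : ∀ x y → Adj (T ∘ suc) (to⁻ x) (to⁻ y) → YΔadj G a b c x y ≡ true
    ⇐ x y e with adj G (suc x) (suc y) in xy
    ... | true = refl
    ... | false with inT a b c x in px | inT a b c y in py | x ≟ y
    ... | true | true | no _ = refl
    ... | true | true | yes refl = ⊥-elim (irreflexive (to⁻ x) e)
      where
      irreflexive : ∀ u → ¬ Adj (T ∘ suc) u u
      irreflexive (inj₂ z) (zz , _) = edge⇒≢ zz refl
    ... | false | _ | _ = trans (sym xy) (Equivalence.from (adj⇔ x y) (Adj-bump⁺ T _ _ e
            λ (p , _) → contradiction (trans (sym px) (On⇒inT x p)) λ ()))
    ... | true | false | _ = trans (sym xy) (Equivalence.from (adj⇔ x y) (Adj-bump⁺ T _ _ e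
            λ (_ , p) → contradiction (trans (sym py) (On⇒inT y p)) λ ()))

  -- Vertex degrees after triangles have been replaced

  Sparse : V → Set
  Sparse x = ∀ y → edge x y ≡ false

  Dense : V → Set
  Dense x = Σ (Fin 7 → V) λ g → Injective _≡_ _≡_ g × (∀ i → edge x (g i) ≡ true)

  -- The listed vertices may coincide; the last component rules out isolated vertices. This property
  -- serves to tell Y-centres from original vertices.
  AtMost3 : Triangles k → Fin k ⊎ V → Set
  AtMost3 T u = ∃ λ (nbr : Triple _) → (∀ v → Adj T u v → v ∈ᵗ nbr) × Adj T u (nbr zero)

  Y-AtMost3 : ∀ (T : Triangles k) i → AtMost3 T (inj₁ i)
  Y-AtMost3 T i = inj₂ ∘ T i , (λ { (inj₂ y) → ∈ᵗ-map inj₂ }) , (zero , refl)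

  -- A Y at `x` would come from a triangle through `x`, hence from an edge at `x`.
  sparse-¬AtMost3 : ∀ {T : Triangles k} {x} → Packing T → Sparse x → ¬ AtMost3 T (inj₂ x)
  sparse-¬AtMost3 {T = T} {x} P none (nbr , _ , a) with nbr zero
  ... | inj₂ y = contradiction (trans (sym (proj₁ a)) (none y)) λ ()
  ... | inj₁ i with a
  ... | p , refl = contradiction (trans (sym (clique P i (p≢p+1 p))) (none _)) λ ()
    where
    p≢p+1 : ∀ p → p ≢ punchIn p zero
    p≢p+1 zero ()
    p≢p+1 (suc p) ()

  -- A Y at x stands for at most two edges at x, so three neighbours account for at most six edges.
  dense-¬AtMost3 : ∀ {T : Triangles k} {x} → Dense x → ¬ AtMost3 T (inj₂ x)
  dense-¬AtMost3 {T = T} {x} (g , g-inj , adjacent) (nbr , all , _) =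
    <⇒notInjective (n<1+n 6) code-injective
    where
    opposite : ∀ {i} → Dec (x ∈ᵗ T i) → Fin 2 → V
    opposite {i} (yes (p , _)) s = T i (punchIn p s)
    -- Arbitrary default for a Y not attached to `x`; `opposite-surjective` concerns only triangles
    -- through `x`.
    opposite (no _) _ = x
    opposite-surjective : ∀ {i y} (d : Dec (x ∈ᵗ T i)) → x ∈ᵗ T i → y ∈ᵗ T i → x ≢ y →
                          ∃ λ s → opposite d s ≡ y
    opposite-surjective (no x∉) x∈ _ _ = contradiction x∈ x∉
    opposite-surjective {i} (yes (p , eq)) _ (q , eq′) x≢y =
      punchOut p≢q , trans (cong (T i) (punchIn-punchOut p≢q)) eq′
      where
      p≢q : p ≢ q
      p≢q refl = x≢y (trans (sym eq) eq′)
    decode : Fin _ ⊎ V → Fin 2 → V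
    decode (inj₂ y) _ = y
    decode (inj₁ i) = opposite (x ∈? T i)
    decode-surjective : ∀ y → edge x y ≡ true → ∃₂ λ j s → decode (nbr j) s ≡ y
    -- A surviving edge is found at the neighbour `y` itself, a covered one at the centre of the Y
    -- replacing it.
    decode-surjective y xy with covers? T x y
    ... | no free with all (inj₂ y) (xy , free)
    ... | j , eq = j , zero , cong (λ u → decode u zero) eq
    decode-surjective y xy | yes (i , x∈ , y∈)
      with all (inj₁ i) x∈ | opposite-surjective (x ∈? T i) x∈ y∈ (edge⇒≢ xy)
    ... | j , eq | s , eq′ = j , s , trans (cong (λ u → decode u s) eq) eq′
    find = λ i → decode-surjective (g i) (adjacent i)
    -- Three entries of `nbr` with two choices each give the six codes.
    code : Fin 7 → Fin 6
    code i = combine (proj₁ (find i)) (proj₁ (proj₂ (find i)))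
    code-injective : Injective _≡_ _≡_ code
    code-injective {i} {j} eq with combine-injective (proj₁ (find i)) _ (proj₁ (find j)) _ eq
    ... | eq₁ , eq₂ = g-inj (trans (sym (proj₂ (proj₂ (find i))))
                            (trans (cong₂ (decode ∘ nbr) eq₁ eq₂) (proj₂ (proj₂ (find j)))))

  Spread : Set
  Spread = ∀ x → Sparse x ⊎ Dense x

  ¬AtMost3 : ∀ {T : Triangles k} → Spread → Packing T → ∀ x → ¬ AtMost3 T (inj₂ x)
  ¬AtMost3 spread P x with spread x
  ... | inj₁ s = sparse-¬AtMost3 P s
  ... | inj₂ d = dense-¬AtMost3 d

  -- Every cousin arises from a packing

  Resolved : Graph → Set
  Resolved H = ∃₂ λ k (T : Triangles k) → Packing T × Models T H

  -- The triangle has only original corners, so it is a triangle of the base graph; its edges have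
  -- survived, so no earlier triangle covers them and it may join the packing.
  ΔY-resolved : ∀ {G : GraphOn m} {a b c} →
                adj G a b ≡ true → adj G b c ≡ true → adj G c a ≡ true →
                Resolved (m , G) → Resolved (ΔY G a b c)
  ΔY-resolved {G = G} {a} {b} {c} ab bc ca (k , T , P , M) =
    suc k , t ◂ T , packing , ΔY-models M hits
    where
    φ = vertex M
    flip-adj : ∀ {x y} → adj G x y ≡ true → adj G y x ≡ true
    flip-adj {x} {y} = trans (GraphOn.adj-sym G y x)
    -- The neighbours of a Y-vertex are pairwise nonadjacent, so it lies on no triangle.
    original : ∀ {x y z} → adj G x y ≡ true → adj G y z ≡ true → adj G z x ≡ true →
               ∃ λ v → to φ x ≡ inj₂ v
    original {x} {y} {z} xy yz zx with to φ x | to φ y | to φ z | adj⇒Adj M xy | adj⇒Adj M yz | adj⇒Adj M zx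
    ... | inj₂ v | _ | _ | _ | _ | _ = v , refl
    ... | inj₁ i | inj₂ _ | inj₂ _ | y∈ | (_ , free) | z∈ = contradiction (i , y∈ , z∈) free
    α = original ab bc ca
    β = original bc ca ab
    γ = original ca ab bc
    t = triple (proj₁ α) (proj₁ β) (proj₁ γ)
    hits : ∀ j → to φ (triple a b c j) ≡ inj₂ (t j)
    hits zero = proj₂ α
    hits (suc zero) = proj₂ β
    hits (suc (suc zero)) = proj₂ γ
    triangle : ∀ p q → p ≢ q → adj G (triple a b c p) (triple a b c q) ≡ true
    triangle zero zero p≢q = contradiction refl p≢q
    triangle zero (suc zero) _ = ab
    triangle zero (suc (suc zero)) _ = flip-adj ca
    triangle (suc zero) zero _ = flip-adj ab
    triangle (suc zero) (suc zero) p≢q = contradiction refl p≢q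
    triangle (suc zero) (suc (suc zero)) _ = bc
    triangle (suc (suc zero)) zero _ = ca
    triangle (suc (suc zero)) (suc zero) _ = flip-adj bc
    triangle (suc (suc zero)) (suc (suc zero)) p≢q = contradiction refl p≢q
    triangle′ : ∀ p q → p ≢ q → Adj T (inj₂ (t p)) (inj₂ (t q))
    triangle′ p q p≢q = subst₂ (Adj T) (hits p) (hits q) (adj⇒Adj M (triangle p q p≢q))
    new : ∀ {x y} → x ≢ y → x ∈ᵗ t → y ∈ᵗ t → ¬ Covers T x y
    new x≢y (p , refl) (q , refl) = proj₂ (triangle′ p q λ { refl → x≢y refl })
    packing : Packing (t ◂ T)
    packing .clique zero p≢q = proj₁ (triangle′ _ _ p≢q)
    packing .clique (suc i) p≢q = clique P i p≢q
    packing .disjoint {zero} {zero} _ _ _ _ _ = refl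
    packing .disjoint {zero} {suc j} x≢y p q r s = contradiction (j , r , s) (new x≢y p q)
    packing .disjoint {suc i} {zero} x≢y p q r s = contradiction (i , p , q) (new x≢y r s)
    packing .disjoint {suc i} {suc j} x≢y p q r s = cong suc (disjoint P x≢y p q r s)

  Packing-tail : ∀ {T : Triangles (suc k)} → Packing T → Packing (T ∘ suc)
  Packing-tail P .clique i = clique P (suc i)
  Packing-tail P .disjoint x≢y p q r s = suc-injective (disjoint P x≢y p q r s)

  reindex : (T : Triangles k) (π : Permutation′ k) → Carry T (T ∘ from π)
  reindex T π = record
    { index = π ; auto = ↔-refl ; edge≡ = λ _ _ → refl
    ; mem⇒ = λ {i} → subst (λ j → _ ∈ᵗ T j) (sym (strictlyInverseʳ π i))
    ; mem⇐ = λ {i} → subst (λ j → _ ∈ᵗ T j) (strictlyInverseʳ π i)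
    }

  Packing-reindex : ∀ {T : Triangles k} (π : Permutation′ k) → Packing T → Packing (T ∘ from π)
  Packing-reindex π P .clique i = clique P (from π i)
  Packing-reindex π P .disjoint x≢y p q r s = to-injective (↔-sym π) (disjoint P x≢y p q r s)

  -- The deleted vertex has three neighbours, so it is not an original vertex. Its triangle is moved
  -- to index zero by a transposition and dropped from the packing.
  YΔ-resolved : ∀ {G : GraphOn (suc m)} {a b c} → Spread →
                (∀ x → adj G zero (suc x) ≡ inT a b c x) →
                Resolved (suc m , G) → Resolved (YΔ G a b c)
  YΔ-resolved {m} {G} {a} {b} {c} spread nbrs (k , T , P , M) with to (vertex M) zero in eq
  ... | inj₂ x = contradiction few (¬AtMost3 spread P x)
    where
    φ = vertex M
    nbr : Triple (Fin k ⊎ V)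
    nbr j = to φ (suc (triple a b c j))
    few : AtMost3 T (inj₂ x)
    few = subst (AtMost3 T) eq (nbr , all , adj⇒Adj M (trans (nbrs a) (∈ᵗ⇒inT a b c a (zero , refl))))
      where
      all′ : ∀ y → adj G zero y ≡ true → to φ y ∈ᵗ nbr
      all′ zero e with () ← trans (sym e) (GraphOn.adj-irr G zero)
      all′ (suc y) e = ∈ᵗ-map (to φ ∘ suc) (inT⇒∈ᵗ a b c y (trans (sym (nbrs y)) e))
      all : ∀ v → Adj T (to φ zero) v → v ∈ᵗ nbr
      all v e = subst (_∈ᵗ nbr) (strictlyInverseˡ φ v)
        (all′ (from φ v) (Adj⇒adj M (subst (Adj T (to φ zero)) (sym (strictlyInverseˡ φ v)) e)))
  YΔ-resolved {m} {G} spread nbrs (suc k , T , P , M) | inj₁ i =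
    k , T′ ∘ suc , Packing-tail P′ , YΔ-models P′ (Models-carry (reindex T π) M) at-zero nbrs
    where
    π : Permutation′ (suc k)
    π = transpose i zero
    T′ = T ∘ from π
    P′ = Packing-reindex π P
    Θ : (Fin (suc k) ⊎ V) ↔ (Fin (suc k) ⊎ V)
    Θ = π ⊎-↔ ↔-refl
    at-zero : to Θ (to (vertex M) zero) ≡ inj₁ zero
    at-zero = trans (cong (to Θ) eq) (cong inj₁ (swap-left i zero))

  Move-resolved : Spread → ∀ {G H} → Move G H → Resolved G → Resolved H
  Move-resolved spread (∇Y-move G a b c H _ ab bc ca iso) R
    with ΔY-resolved {G = G} ab bc ca R
  ... | k , T , P , M = k , T , P , Models-≅ iso M
  Move-resolved spread (Y∇-move G′ G a b c H iso _ nbrs _ _ _ iso′) (k , T , P , M)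
    with YΔ-resolved {G = G′} spread nbrs (k , T , P , Models-≅ (≅-sym (_ , G′) G iso) M)
  ... | k′ , T′ , P′ , M′ = k′ , T′ , P′ , Models-≅ iso′ M′

  Cousin-resolved : Spread → ∀ {G H} → Resolved G → Cousin G H → Resolved H
  Cousin-resolved spread {G} R (H′ , moves , iso) with go moves R
    where
    go : ∀ {G H} → Star Move G H → Resolved G → Resolved H
    go ε R = R
    go (move ◅ moves) R = go moves (Move-resolved spread move R)
  ... | k , T , P , M = k , T , P , Models-≅ iso M

  -- All functions out of `Fin 0` are quantified over, because two of them need not be
  -- definitionally equal.
  Unresolved : Graph → Set
  Unresolved G = ∀ {T : Triangles 0} → Models T G

  unresolved : {G : GraphOn n} (χ : V ↔ Fin n) →
               (∀ x y → adj G (to χ x) (to χ y) ≡ edge x y) → Unresolved (n , G)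
  unresolved {G = G} χ eq {T} = record
    { vertex = mk↔ₛ′ (inj₂ ∘ from χ) (λ { (inj₁ ()) ; (inj₂ x) → to χ x })
        (λ { (inj₁ ()) ; (inj₂ x) → cong inj₂ (strictlyInverseʳ χ x) }) (strictlyInverseˡ χ)
    ; adj⇒Adj = λ {x} {y} xy → trans (sym (eq′ x y)) xy , λ { (() , _) }
    ; Adj⇒adj = λ {x} {y} (xy , _) → trans (eq′ x y) xy
    }
    where
    eq′ : ∀ x y → adj G x y ≡ edge (from χ x) (from χ y)
    eq′ x y = trans (cong₂ (adj G) (sym (strictlyInverseˡ χ x)) (sym (strictlyInverseˡ χ y)))
                    (eq (from χ x) (from χ y))

  -- Triangles are replaced one at a time, the tail first. The edges of `T zero` are still present
  -- at the last move because no other triangle covers them.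
  realise : ∀ {G} → Unresolved G → (T : Triangles k) → Packing T →
            ∃ λ H → Star Move G H × Models T H
  realise {k = zero} M T P = _ , ε , M
  realise {k = suc k} M T P with realise M (T ∘ suc) (Packing-tail P)
  ... | (m , H) , moves , M′ =
    H⁺ ,
    moves ◅◅ (∇Y-move H _ _ _ _ (v-≢ (λ ()) , v-≢ (λ ()) , v-≢ (λ ()))
                (v-adj (λ ())) (v-adj (λ ())) (v-adj (λ ())) (≅-refl H⁺) ◅ ε) ,
    ΔY-models M′ λ where
      zero             → strictlyInverseˡ φ _
      (suc zero)       → strictlyInverseˡ φ _
      (suc (suc zero)) → strictlyInverseˡ φ _
    where
    φ = vertex M′
    v : Triple (Fin m)
    v j = from φ (inj₂ (T zero j))
    H⁺ = ΔY H (v zero) (v (suc zero)) (v (suc (suc zero)))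
    v-≢ : ∀ {p q} → p ≢ q → v p ≢ v q
    v-≢ p≢q eq = edge⇒≢ (clique P zero p≢q) (inj₂-injective (to-injective (↔-sym φ) eq))
    v-adj : ∀ {p q} → p ≢ q → adj H (v p) (v q) ≡ true
    v-adj {p} {q} p≢q = Adj⇒adj M′ (subst₂ (Adj (T ∘ suc))
      (sym (strictlyInverseˡ φ _)) (sym (strictlyInverseˡ φ _))
      (clique P zero p≢q , λ (i , r , s) →
        contradiction (disjoint P (edge⇒≢ (clique P zero p≢q)) (p , refl) (q , refl) r s) λ ()))

  carry⇒≅ : ∀ {T : Triangles k} {T′ : Triangles l} {H X} →
            Models T H → Models T′ X → Carry T T′ → H ≅ X
  carry⇒≅ M M′ carry = Models⇒≅ (Models-carry carry M) M′

  -- Isomorphic cousins have equivalent packings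

  record Adj-↔ (T : Triangles k) (T′ : Triangles l) : Set where
    field
      bijection : (Fin k ⊎ V) ↔ (Fin l ⊎ V)
      push : ∀ {u v} → Adj T u v → Adj T′ (to bijection u) (to bijection v)
      pull : ∀ {u v} → Adj T′ u v → Adj T (from bijection u) (from bijection v)

  open Adj-↔

  Adj-↔-sym : ∀ {T : Triangles k} {T′ : Triangles l} → Adj-↔ T T′ → Adj-↔ T′ T
  Adj-↔-sym Θ = record { bijection = ↔-sym (bijection Θ) ; push = pull Θ ; pull = push Θ }

  Models-Adj-↔ : ∀ {T : Triangles k} {T′ : Triangles l} {H} → Models T H → Models T′ H → Adj-↔ T T′
  Models-Adj-↔ {T = T} {T′} M M′ = record
    { bijection = ↔-trans (↔-sym (vertex M)) (vertex M′)
    ; push = adj⇒Adj M′ ∘ via M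
    ; pull = adj⇒Adj M ∘ via M′
    }
    where
    via : ∀ {k} {T : Triangles k} {H} (M : Models T H) {u v} → Adj T u v →
          adj (proj₂ H) (from (vertex M) u) (from (vertex M) v) ≡ true
    via {T = T} M e = Adj⇒adj M
      (subst₂ (Adj T) (sym (strictlyInverseˡ (vertex M) _)) (sym (strictlyInverseˡ (vertex M) _)) e)

  -- The property `AtMost3` is preserved by isomorphism, and original vertices never have it.
  Y↦Y : ∀ {T : Triangles k} {T′ : Triangles l} → Spread → Packing T′ → (Θ : Adj-↔ T T′) →
        ∀ i → ∃ λ j → to (bijection Θ) (inj₁ i) ≡ inj₁ j
  Y↦Y {T = T} {T′} spread P′ Θ i with to (bijection Θ) (inj₁ i) in eq
  ... | inj₁ j = j , refl
  ... | inj₂ x with Y-AtMost3 T i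
  ... | nbr , all , a = contradiction (to (bijection Θ) ∘ nbr , all′ , a′) (¬AtMost3 spread P′ x)
    where
    all′ : ∀ v → Adj T′ (inj₂ x) v → v ∈ᵗ (to (bijection Θ) ∘ nbr)
    all′ v e = subst (_∈ᵗ (to (bijection Θ) ∘ nbr)) (strictlyInverseˡ (bijection Θ) v)
      (∈ᵗ-map (to (bijection Θ)) (all _ (subst (λ u → Adj T u (from (bijection Θ) v)) (to≡⇒from≡ (bijection Θ) eq) (pull Θ e))))
    a′ : Adj T′ (inj₂ x) (to (bijection Θ) (nbr zero))
    a′ = subst (λ u → Adj T′ u (to (bijection Θ) (nbr zero))) eq (push Θ {inj₁ i} {nbr zero} a)

  V↦V : ∀ {T : Triangles k} {T′ : Triangles l} → Spread → Packing T → (Θ : Adj-↔ T T′) →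
        ∀ x → ∃ λ y → to (bijection Θ) (inj₂ x) ≡ inj₂ y
  V↦V spread P Θ x with to (bijection Θ) (inj₂ x) in eq
  ... | inj₂ y = y , refl
  ... | inj₁ j with Y↦Y spread P (Adj-↔-sym Θ) j
  ... | i , eq′ with () ← trans (sym (to≡⇒from≡ (bijection Θ) eq)) eq′

  -- The isomorphism respects centres and original vertices, so it splits. Incidence with centres
  -- gives the action on triangles; the base edges are recovered as surviving edges or as sides of
  -- triangles.
  ≅⇒carry : ∀ {T : Triangles k} {T′ : Triangles l} {H X} → Spread → Packing T → Packing T′ →
            Models T H → Models T′ X → H ≅ X → Carry T T′
  ≅⇒carry {T = T} {T′} {H} {X} spread P P′ M M′ iso
    with Θ ← Models-Adj-↔ M (Models-≅ (≅-sym H X iso) M′)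
    with index , auto , on-Y , on-V ← split-↔ (bijection Θ) (Y↦Y spread P′ Θ) (V↦V spread P Θ)
    = record { index = index ; auto = auto ; mem⇒ = mem⇒ ; mem⇐ = mem⇐
             ; edge≡ = λ x y → ⇔→≡ {z = true} (mk⇔ edge⇒ edge⇐) }
    where
    mem⇒ : ∀ {i x} → x ∈ᵗ T i → to auto x ∈ᵗ T′ (to index i)
    mem⇒ {i} {x} p = subst₂ (Adj T′) (on-Y i) (on-V x) (push Θ {inj₁ i} {inj₂ x} p)
    mem⇐ : ∀ {i x} → to auto x ∈ᵗ T′ (to index i) → x ∈ᵗ T i
    mem⇐ {i} {x} p = subst₂ (Adj T) (to≡⇒from≡ (bijection Θ) (on-Y i))
      (to≡⇒from≡ (bijection Θ) (on-V x)) (pull Θ {inj₁ (to index i)} {inj₂ (to auto x)} p)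
    edge⇒ : ∀ {x y} → edge x y ≡ true → edge (to auto x) (to auto y) ≡ true
    edge⇒ {x} {y} xy with covers? T x y
    ... | yes (i , p , q) = ∈⇒edge P′ (mem⇒ p) (mem⇒ q) (edge⇒≢ xy ∘ to-injective auto)
    ... | no free = proj₁ (subst₂ (Adj T′) (on-V x) (on-V y) (push Θ {inj₂ x} {inj₂ y} (xy , free)))
    edge⇐ : ∀ {x y} → edge (to auto x) (to auto y) ≡ true → edge x y ≡ true
    edge⇐ {x} {y} xy with covers? T′ (to auto x) (to auto y)
    ... | yes (i , p , q) = ∈⇒edge P (mem⇐ (at p)) (mem⇐ (at q)) λ { refl → edge⇒≢ xy refl }
      where
      at : ∀ {z} → z ∈ᵗ T′ i → z ∈ᵗ T′ (to index (from index i))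
      at = subst (λ j → _ ∈ᵗ T′ j) (sym (strictlyInverseˡ index i))
    ... | no free = proj₁ (subst₂ (Adj T) (to≡⇒from≡ (bijection Θ) (on-V x))
      (to≡⇒from≡ (bijection Θ) (on-V y)) (pull Θ {inj₂ (to auto x)} {inj₂ (to auto y)} (xy , free)))

-- Edges as elements of Fin (numEdges G)

module Edges {n : ℕ} (G : GraphOn n) where

  adjacent? : (p : Fin n × Fin n) → Dec (adj G (proj₁ p) (proj₂ p) ≡ true)
  adjacent? p = adj G (proj₁ p) (proj₂ p) Data.Bool.≟ true

  increasing? : (p : Fin n × Fin n) → Dec (proj₁ p Data.Fin.< proj₂ p)
  increasing? p = proj₁ p <? proj₂ p

  pairs : List (Fin n × Fin n)
  pairs = concatMap (λ x → map (λ y → (x , y)) (allFin n)) (allFin n)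

  -- The same expression as in `numEdges`, so that positions in this list are definitionally
  -- elements of `Fin (numEdges (n , G))`.
  edges : List (Fin n × Fin n)
  edges = filter increasing? (filter adjacent? pairs)

  ∈-edges : ∀ {x y} → adj G x y ≡ true → x Data.Fin.< y → (x , y) ∈ edges
  ∈-edges {x} {y} xy x<y = ∈-filter⁺ _ (∈-filter⁺ _
    (∈-concatMap⁺ _ (Any-map (λ { refl → ∈-map⁺ (x ,_) (∈-allFin y) }) (∈-allFin x))) xy) x<y

  orient : ∀ {x y} → adj G x y ≡ true →
           ∃ λ p → p ∈ edges × (p ≡ (x , y) ⊎ p ≡ (y , x))
  orient {x} {y} xy with <-cmp x y
  ... | tri< x<y _ _ = _ , ∈-edges xy x<y , inj₁ refl
  ... | tri> _ _ y<x = _ , ∈-edges (trans (GraphOn.adj-sym G y x) xy) y<x , inj₂ refl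
  ... | tri≈ _ refl _ with () ← trans (sym xy) (GraphOn.adj-irr G x)

  edgeIndex : ∀ {x y} → adj G x y ≡ true → Fin (numEdges (n , G))
  edgeIndex xy = Any-index (proj₁ (proj₂ (orient xy)))

  -- Each edge is listed in its increasing orientation only, so an index determines an unordered
  -- pair.
  edgeIndex-injective : ∀ {x y x′ y′} (xy : adj G x y ≡ true) (xy′ : adj G x′ y′ ≡ true) →
    edgeIndex xy ≡ edgeIndex xy′ → (x ≡ x′ × y ≡ y′) ⊎ (x ≡ y′ × y ≡ x′)
  edgeIndex-injective xy xy′ eq with orient xy | orient xy′
  ... | p , p∈ , o | p′ , p′∈ , o′
    with trans (lookup-index p∈) (trans (cong (lookup edges) eq) (sym (lookup-index p′∈))) | o | o′
  ... | refl | inj₁ refl | inj₁ refl = inj₁ (refl , refl)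
  ... | refl | inj₁ refl | inj₂ refl = inj₂ (refl , refl)
  ... | refl | inj₂ refl | inj₁ refl = inj₂ (refl , refl)
  ... | refl | inj₂ refl | inj₂ refl = inj₁ (refl , refl)

  edgeAt : Fin (numEdges (n , G)) → ∃₂ λ x y → adj G x y ≡ true
  edgeAt i = _ , _ , proj₂ (∈-filter⁻ adjacent? {xs = pairs}
    (proj₁ (∈-filter⁻ increasing? {xs = filter adjacent? pairs} (∈-lookup {xs = edges} i))))

injective⇒surjective : {f : Fin n → Fin n} → Injective _≡_ _≡_ f → ∀ y → ∃ λ x → f x ≡ y
injective⇒surjective {n = suc n} {f} f-inj y with any? (λ x → f x ≟ y)
... | yes found = found
... | no missed = contradiction
  (λ {x} {x′} eq → f-inj (punchOut-injective (avoid x) (avoid x′) eq)) (<⇒notInjective (n<1+n n))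
  where
  avoid : ∀ x → y ≢ f x
  avoid x eq = missed (x , sym eq)

-- Joins with an independent set

true≢false : true ≢ false
true≢false ()

module Join {N : ℕ} (B : GraphOn N) where
  open Edges B

  e : ℕ
  e = numEdges (N , B)

  private variable
    c d : ℕ

  joinEdge : Fin N ⊎ Fin c → Fin N ⊎ Fin c → Bool
  joinEdge (inj₁ x) (inj₁ y) = adj B x y
  joinEdge (inj₁ x) (inj₂ w) = true
  joinEdge (inj₂ w) (inj₁ x) = true
  joinEdge (inj₂ w) (inj₂ v) = false

  J : ℕ → Base
  J c = record
    { V = Fin N ⊎ Fin c
    ; _≟ᵛ_ = ⊎-≡-dec _≟_ _≟_
    ; edge = joinEdge
    ; edge-irr = λ where
        (inj₁ x) → GraphOn.adj-irr B x
        (inj₂ _) → refl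
    }

  open Resolve using (Triangles; Packing; Carry; Spread; Dense; _∈?_)

  adj⇒≢ : ∀ {x y} → adj B x y ≡ true → x ≢ y
  adj⇒≢ {x} xy refl = true≢false (trans (sym xy) (GraphOn.adj-irr B x))

  dense-W : 7 ≤ N → (w : Fin c) → Dense (J c) (inj₂ w)
  dense-W 7≤N w =
      (λ i → inj₁ (inject≤ i 7≤N))
    , (λ eq → inject≤-injective 7≤N 7≤N _ _ (inj₁-injective eq)) , λ _ → refl

  -- The vertices outside B are independent, so at most one corner lies among them.
  base-edge : ∀ {T : Triangles (J c) k} → Packing (J c) T → ∀ i →
              ∃₂ λ x y → adj B x y ≡ true × inj₁ x ∈ᵗ T i × inj₁ y ∈ᵗ T i
  base-edge {c} {T = T} P i = go _ _ _ refl refl refl (clique i λ ()) (clique i λ ()) (clique i λ ())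
    where
    open Resolve.Packing P
    go : ∀ u v w → T i zero ≡ u → T i (suc zero) ≡ v → T i (suc (suc zero)) ≡ w →
         joinEdge u v ≡ true → joinEdge u w ≡ true → joinEdge v w ≡ true →
         ∃₂ λ x y → adj B x y ≡ true × inj₁ x ∈ᵗ T i × inj₁ y ∈ᵗ T i
    go (inj₁ x) (inj₁ y) _ e₀ e₁ _ xy _ _ = x , y , xy , (_ , e₀) , (_ , e₁)
    go (inj₁ x) (inj₂ _) (inj₁ z) e₀ _ e₂ _ xz _ = x , z , xz , (_ , e₀) , (_ , e₂)
    go (inj₂ _) (inj₁ y) (inj₁ z) _ e₁ e₂ _ _ yz = y , z , yz , (_ , e₁) , (_ , e₂)

  emb : e ≤ c → Fin N ⊎ Fin e → Fin N ⊎ Fin c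
  emb e≤c = map₂ (λ w → inject≤ w e≤c)

  emb-injective : ∀ (e≤c : e ≤ c) {u v} → emb e≤c u ≡ emb e≤c v → u ≡ v
  emb-injective e≤c {inj₁ x} {inj₁ y} refl = refl
  emb-injective e≤c {inj₂ w} {inj₂ v} eq =
    cong inj₂ (inject≤-injective e≤c e≤c w v (inj₂-injective eq))

  emb-edge : ∀ (e≤c : e ≤ c) u v → joinEdge (emb e≤c u) (emb e≤c v) ≡ joinEdge u v
  emb-edge e≤c (inj₁ _) (inj₁ _) = refl
  emb-edge e≤c (inj₁ _) (inj₂ _) = refl
  emb-edge e≤c (inj₂ _) (inj₁ _) = refl
  emb-edge e≤c (inj₂ _) (inj₂ _) = refl

  embed : e ≤ c → Triangles (J e) k → Triangles (J c) k
  embed e≤c S i = emb e≤c ∘ S i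

  Packing-embed : ∀ (e≤c : e ≤ c) {S : Triangles (J e) k} → Packing (J e) S → Packing (J c) (embed e≤c S)
  Packing-embed e≤c {S} P = record
    { clique = λ i {p} {q} p≢q → trans (emb-edge e≤c (S i p) (S i q)) (clique i p≢q)
    ; disjoint = λ where
        x≢y (p , refl) (q , refl) (p′ , eq) (q′ , eq′) →
          disjoint (λ eq → x≢y (cong (emb e≤c) eq)) (p , refl) (q , refl)
            (p′ , emb-injective e≤c eq) (q′ , emb-injective e≤c eq′)
    }
    where open Resolve.Packing P

  swap-W : Permutation′ c → (Fin N ⊎ Fin c) ↔ (Fin N ⊎ Fin c)
  swap-W π = ↔-refl ⊎-↔ π

  -- Distinct triangles contain distinct edges of B, so a packing meets at most e vertices
  -- outside B, and these can be permuted into the first e positions.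
  normalise : ∀ (e≤c : e ≤ c) {T : Triangles (J c) k} → Packing (J c) T →
              ∃ λ (S : Triangles (J e) k) → Packing (J e) S × Carry (J c) T (embed e≤c S)
  normalise {c} {k} e≤c {T} P = S , S-packing , record
    { index = ↔-refl ; auto = Ψ ; edge≡ = edge≡
    ; mem⇒ = λ {i} (j , eq) → j , trans (sym (S-spec i j)) (cong (to Ψ) eq)
    ; mem⇐ = λ {i} (j , eq) → j , to-injective Ψ (trans (S-spec i j) eq)
    }
    where
    open Resolve.Packing P
    slot : Fin k → Fin e
    slot i = edgeIndex (proj₁ (proj₂ (proj₂ (base-edge P i))))
    slot-injective : ∀ {i j} → slot i ≡ slot j → i ≡ j
    -- Triangles owning the same edge of B share its two ends, hence coincide.
    slot-injective {i} {j} eq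
      with x , y , xy , x∈ , y∈ ← base-edge P i
      with x′ , y′ , xy′ , x′∈ , y′∈ ← base-edge P j
      with edgeIndex-injective xy xy′ eq
    ... | inj₁ (refl , refl) = disjoint (adj⇒≢ xy ∘ inj₁-injective) x∈ y∈ x′∈ y′∈
    ... | inj₂ (refl , refl) = disjoint (adj⇒≢ xy ∘ inj₁-injective) x∈ y∈ y′∈ x′∈
    W-unique : ∀ {i w v} → inj₂ w ∈ᵗ T i → inj₂ v ∈ᵗ T i → w ≡ v
    W-unique {i} {w} {v} w∈ v∈ with w ≟ v
    ... | yes w≡v = w≡v
    ... | no w≢v with () ← ∈⇒edge w∈ v∈ (w≢v ∘ inj₂-injective)
    Owner : Fin c → Set
    Owner w = ∃ λ i → inj₂ w ∈ᵗ T i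
    owner? : ∀ w → Dec (Owner w)
    owner? w = any? (λ i → _∈?_ (J c) (inj₂ w) (T i))
    -- A vertex of W on several triangles takes the slot of the one found by `owner?`. Distinct
    -- vertices receive distinct slots, as a triangle has at most one vertex in W.
    target : ∀ {w} → Dec (Owner w) → Maybe (Fin e)
    target (yes (i , _)) = just (slot i)
    target (no _) = nothing
    target-injective : ∀ {w v s} (p : Dec (Owner w)) (q : Dec (Owner v)) →
                       target p ≡ just s → target q ≡ just s → w ≡ v
    target-injective (yes (i , w∈)) (yes (j , v∈)) refl eq
      with refl ← slot-injective {j} {i} (just-injective eq) = W-unique w∈ v∈
    Goes : Fin c → Fin c → Set
    Goes w v = ∃ λ s → target (owner? w) ≡ just s × inject≤ s e≤c ≡ v
    extension = extend-to-permutation Goes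
      (λ w v → any? (λ s → Maybe-≡-dec _≟_ (target (owner? w)) (just s) ×-dec (inject≤ s e≤c ≟ v)))
      (λ { (_ , eq , refl) (_ , eq′ , refl) →
             cong (λ s → inject≤ s e≤c) (just-injective (trans (sym eq) eq′)) })
      (λ { {w} {v} (_ , eq , refl) (s′ , eq′ , eq″) → target-injective (owner? w) (owner? v) eq
             (trans eq′ (cong just (inject≤-injective e≤c e≤c s′ _ eq″))) })
    π = proj₁ extension
    Ψ = swap-W π
    edge≡ : ∀ u v → joinEdge u v ≡ joinEdge (to Ψ u) (to Ψ v)
    edge≡ (inj₁ _) (inj₁ _) = refl
    edge≡ (inj₁ _) (inj₂ _) = refl
    edge≡ (inj₂ _) (inj₁ _) = refl
    edge≡ (inj₂ _) (inj₂ _) = refl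
    shrink : ∀ i j u → T i j ≡ u → ∃ λ s → to Ψ u ≡ emb e≤c s
    shrink i j (inj₁ x) _ = inj₁ x , refl
    shrink i j (inj₂ w) eq with owner? w in found
    ... | yes (i′ , _) = inj₂ (slot i′) ,
      cong inj₂ (proj₂ extension {w} (slot i′ , cong target found , refl))
    ... | no unowned = contradiction (i , j , eq) unowned
    S : Triangles (J e) k
    S i j = proj₁ (shrink i j (T i j) refl)
    S-spec : ∀ i j → to Ψ (T i j) ≡ emb e≤c (S i j)
    S-spec i j = proj₂ (shrink i j (T i j) refl)
    S-packing : Packing (J e) S
    S-packing = record
      { clique = λ i {p} {q} p≢q → trans (sym (emb-edge e≤c (S i p) (S i q)))
          (trans (cong₂ joinEdge (sym (S-spec i p)) (sym (S-spec i q)))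
            (trans (sym (edge≡ (T i p) (T i q))) (clique i p≢q)))
      ; disjoint = λ x≢y p q r s → disjoint
          (λ eq → x≢y (emb-injective e≤c (to-injective (↔-sym Ψ) eq))) (lift p) (lift q) (lift r) (lift s)
      }
      where
      lift : ∀ {i s} → s ∈ᵗ S i → from Ψ (emb e≤c s) ∈ᵗ T i
      lift {i} (j , refl) = j , sym (to≡⇒from≡ Ψ (S-spec i j))

  -- Base graphs that are stars

  module StarBase (h : Fin N) (hub : ∀ x → x ≢ h → adj B x h ≡ true)
              (independent : ∀ x y → x ≢ h → y ≢ h → adj B x y ≡ false) where

    colB : ∀ {x} → Dec (x ≡ h) → Fin 3
    colB (yes _) = zero
    colB (no _) = suc zero

    -- The join of a star with W is complete tripartite, with the hub, the leaves and W as its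
    -- classes.
    col : Fin N ⊎ Fin c → Fin 3
    col (inj₁ x) = colB (x ≟ h)
    col (inj₂ _) = suc (suc zero)

    edge-col : ∀ (u v : Fin N ⊎ Fin c) → joinEdge u v ≡ not ⌊ col u ≟ col v ⌋
    edge-col (inj₂ _) (inj₂ _) = refl
    edge-col (inj₁ x) (inj₂ _) with x ≟ h
    ... | yes _ = refl
    ... | no _ = refl
    edge-col (inj₂ _) (inj₁ x) with x ≟ h
    ... | yes _ = refl
    ... | no _ = refl
    edge-col (inj₁ x) (inj₁ y) with x ≟ h | y ≟ h
    ... | yes refl | yes refl = GraphOn.adj-irr B h
    ... | yes refl | no y≢h = trans (GraphOn.adj-sym B x y) (hub y y≢h)
    ... | no x≢h | yes refl = hub x x≢h
    ... | no x≢h | no y≢h = independent x y x≢h y≢h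

    col-hub : ∀ {u : Fin N ⊎ Fin c} → col u ≡ zero → u ≡ inj₁ h
    col-hub {u = inj₁ x} eq with yes refl ← x ≟ h = refl

    module Colours {T : Triangles (J c) k} (P : Packing (J c) T) where
      open Resolve.Packing P

      same-colour : ∀ {i u v} → u ∈ᵗ T i → v ∈ᵗ T i → col u ≡ col v → u ≡ v
      same-colour {u = u} {v} u∈ v∈ eq with Base._≟ᵛ_ (J c) u v
      ... | yes u≡v = u≡v
      ... | no u≢v = contradiction (trans (sym (∈⇒edge u∈ v∈ u≢v)) (trans (edge-col u v) same)) true≢false
        where
        same : not ⌊ col u ≟ col v ⌋ ≡ false
        same with col u ≟ col v
        ... | yes _ = refl
        ... | no ≢ = contradiction eq ≢

      every-colour : ∀ i q → ∃ λ u → u ∈ᵗ T i × col u ≡ q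
      every-colour i q = let p , eq = injective⇒surjective injective q in T i p , (p , refl) , eq
        where
        injective : Injective _≡_ _≡_ (col ∘ T i)
        injective {p} {q} eq with p ≟ q
        ... | yes p≡q = p≡q
        ... | no p≢q = contradiction (same-colour (p , refl) (q , refl) eq)
                         (Resolve.edge⇒≢ (J c) (clique i p≢q))

      hub∈ : ∀ i → inj₁ h ∈ᵗ T i
      hub∈ i with every-colour i zero
      ... | u , u∈ , eq = subst (_∈ᵗ T i) (col-hub eq) u∈

      -- Every triangle contains the hub, so any other common vertex gives two triangles a common
      -- edge.
      off-hub-unique : ∀ {i j u} → u ≢ inj₁ h → u ∈ᵗ T i → u ∈ᵗ T j → i ≡ j
      off-hub-unique {i} {j} u≢h p q = disjoint u≢h p (hub∈ i) q (hub∈ j)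

    -- A triangle takes one vertex of each colour and contains the hub, so its other two vertices
    -- lie on no other triangle and can be matched up independently.
    star-carry : ∀ {T : Triangles (J c) k} {T′ : Triangles (J c) l} → Packing (J c) T → Packing (J c) T′ →
                 Fin k ↔ Fin l → Carry (J c) T T′
    star-carry {c} {k} {l} {T} {T′} P P′ θ = record
      { index = θ ; auto = Ψ ; mem⇒ = mem⇒ ; mem⇐ = mem⇐
      ; edge≡ = λ u v → trans (edge-col u v) (trans
          (cong₂ (λ p q → not ⌊ p ≟ q ⌋) (sym (col-Ψ u)) (sym (col-Ψ v))) (sym (edge-col (to Ψ u) (to Ψ v)))) }
      where
      module C = Colours P
      module C′ = Colours P′
      _∈ʷ_ = _∈?_ (J c)
      Matched : Fin N ⊎ Fin c → Fin N ⊎ Fin c → Set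
      Matched u v = ∃ λ i → u ∈ᵗ T i × v ∈ᵗ T′ (to θ i)
      matched? : ∀ u v → Dec (Matched u v)
      matched? u v = any? (λ i → (u ∈ʷ T i) ×-dec (v ∈ʷ T′ (to θ i)))
      functional : ∀ {u v v′} → u ≢ inj₁ h → col v ≡ col v′ → Matched u v → Matched u v′ → v ≡ v′
      functional u≢h eq (i , u∈ , v∈) (j , u∈′ , v′∈) with refl ← C.off-hub-unique u≢h u∈ u∈′ =
        C′.same-colour v∈ v′∈ eq
      injective : ∀ {u u′ v} → v ≢ inj₁ h → col u ≡ col u′ → Matched u v → Matched u′ v → u ≡ u′
      injective v≢h eq (i , u∈ , v∈) (j , u′∈ , v∈′)
        with refl ← to-injective θ (C′.off-hub-unique v≢h v∈ v∈′) = C.same-colour u∈ u′∈ eq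
      onW = extend-to-permutation (λ w v → Matched (inj₂ w) (inj₂ v)) (λ w v → matched? (inj₂ w) (inj₂ v))
        (λ r s → inj₂-injective (functional (λ ()) refl r s))
        (λ r s → inj₂-injective (injective (λ ()) refl r s))
      -- `Matched` alone would pair the hub with leaves, since both lie on triangles; the hub is
      -- therefore treated apart.
      OnB : Fin N → Fin N → Set
      OnB x y = (x ≡ h × y ≡ h) ⊎ ((x ≢ h × y ≢ h) × Matched (inj₁ x) (inj₁ y))
      on-hub : col {c} (inj₁ h) ≡ zero
      on-hub with h ≟ h
      ... | yes _ = refl
      ... | no h≢h = contradiction refl h≢h
      off-hub : ∀ {x} → x ≢ h → col {c} (inj₁ x) ≡ suc zero
      off-hub {x} x≢h with x ≟ h
      ... | yes eq = contradiction eq x≢h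
      ... | no _ = refl
      both-off : ∀ {x y} → x ≢ h → y ≢ h → col {c} (inj₁ x) ≡ col {c} (inj₁ y)
      both-off x≢h y≢h = trans (off-hub x≢h) (sym (off-hub y≢h))
      onB = extend-to-permutation OnB
        (λ x y → ((x ≟ h) ×-dec (y ≟ h)) ⊎-dec
                 ((¬? (x ≟ h) ×-dec ¬? (y ≟ h)) ×-dec matched? (inj₁ x) (inj₁ y)))
        (λ where
          (inj₁ (_ , refl)) (inj₁ (_ , refl)) → refl
          (inj₁ (x≡h , _)) (inj₂ ((x≢h , _) , _)) → contradiction x≡h x≢h
          (inj₂ ((x≢h , _) , _)) (inj₁ (x≡h , _)) → contradiction x≡h x≢h
          (inj₂ ((x≢h , y≢h) , r)) (inj₂ ((_ , y′≢h) , s)) →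
            inj₁-injective (functional (x≢h ∘ inj₁-injective) (both-off y≢h y′≢h) r s))
        (λ where
          (inj₁ (refl , _)) (inj₁ (refl , _)) → refl
          (inj₁ (_ , y≡h)) (inj₂ ((_ , y≢h) , _)) → contradiction y≡h y≢h
          (inj₂ ((_ , y≢h) , _)) (inj₁ (_ , y≡h)) → contradiction y≡h y≢h
          (inj₂ ((x≢h , y≢h) , r)) (inj₂ ((x′≢h , _) , s)) →
            inj₁-injective (injective (y≢h ∘ inj₁-injective) (both-off x≢h x′≢h) r s))
      β = proj₁ onB
      ω = proj₁ onW
      Ψ : (Fin N ⊎ Fin c) ↔ (Fin N ⊎ Fin c)
      Ψ = β ⊎-↔ ω
      β-hub : to β h ≡ h
      β-hub = proj₂ onB (inj₁ (refl , refl))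
      col-Ψ : ∀ u → col (to Ψ u) ≡ col u
      col-Ψ (inj₂ _) = refl
      col-Ψ (inj₁ x) with x ≟ h
      ... | yes refl = trans (cong (col {c} ∘ inj₁) β-hub) on-hub
      ... | no x≢h = off-hub (λ eq → x≢h (to-injective β (trans eq (sym β-hub))))
      matched⇒Ψ : ∀ {i} u v → u ∈ᵗ T i → v ∈ᵗ T′ (to θ i) → col v ≡ col u → to Ψ u ≡ v
      matched⇒Ψ (inj₂ w) (inj₂ v) w∈ v∈ _ = cong inj₂ (proj₂ onW (_ , w∈ , v∈))
      matched⇒Ψ (inj₁ x) (inj₁ y) x∈ y∈ eq with x ≟ h | y ≟ h
      ... | yes refl | yes refl = cong inj₁ β-hub
      ... | no x≢h | no y≢h = cong inj₁ (proj₂ onB (inj₂ ((x≢h , y≢h) , _ , x∈ , y∈)))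
      matched⇒Ψ (inj₁ x) (inj₂ v) _ _ eq with x ≟ h
      matched⇒Ψ (inj₁ x) (inj₂ v) _ _ () | yes _
      matched⇒Ψ (inj₁ x) (inj₂ v) _ _ () | no _
      matched⇒Ψ (inj₂ w) (inj₁ y) _ _ eq with y ≟ h
      matched⇒Ψ (inj₂ w) (inj₁ y) _ _ () | yes _
      matched⇒Ψ (inj₂ w) (inj₁ y) _ _ () | no _
      mem⇒ : ∀ {i u} → u ∈ᵗ T i → to Ψ u ∈ᵗ T′ (to θ i)
      mem⇒ {i} {u} u∈ with C′.every-colour (to θ i) (col u)
      ... | v , v∈ , eq = subst (_∈ᵗ T′ (to θ i)) (sym (matched⇒Ψ u v u∈ v∈ eq)) v∈
      mem⇐ : ∀ {i u} → to Ψ u ∈ᵗ T′ (to θ i) → u ∈ᵗ T i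
      -- The corner of `T i` with the colour of `u` is sent to the corner of `T′ (to θ i)` with that
      -- colour, which is `to Ψ u`; so it equals `u`.
      mem⇐ {i} {u} Ψu∈ with C.every-colour i (col u)
      ... | v , v∈ , eq = subst (_∈ᵗ T i)
        (to-injective Ψ (C′.same-colour (mem⇒ v∈) Ψu∈ (trans (col-Ψ v) (trans eq (sym (col-Ψ u)))))) v∈

  -- Complete multipartite bases with at least one edge

  module _ (nonadj-trans : ∀ {x y z} → adj B x y ≡ false → adj B y z ≡ false → adj B x z ≡ false)
           {u v : Fin N} (uv : adj B u v ≡ true) where

    flip-adj : ∀ {x y b} → adj B x y ≡ b → adj B y x ≡ b
    flip-adj {x} {y} = trans (GraphOn.adj-sym B y x)

    -- Nonadjacency is an equivalence relation, so adjacency to `z` depends only on the class.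
    adj-shift : ∀ {x y z} → adj B x y ≡ false → adj B y z ≡ true → adj B x z ≡ true
    adj-shift {x} {y} {z} xy yz with adj B x z in xz
    ... | true = refl
    ... | false = contradiction (trans (sym yz) (nonadj-trans (flip-adj xy) xz)) true≢false

    neighbour : ∀ x → ∃ λ y → adj B x y ≡ true
    neighbour x with adj B x u in xu
    ... | true = u , xu
    ... | false = v , adj-shift xu uv

    -- The edges used form a spanning double star: a neighbour of `v` takes its edge to `v`, any
    -- other vertex except `v` its edge to `u`, and `v` takes the spare value `zero`.
    order≤1+size : N ≤ suc e
    order≤1+size = injective⇒≤ {f = f} λ {x} {y} eq → f-injective x y (code x) (code y) eq
      where
      Code : Fin N → Set
      Code x = x ≡ v ⊎ adj B x v ≡ true ⊎ (x ≢ v × adj B x v ≡ false × adj B x u ≡ true)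
      code : ∀ x → Code x
      code x with x ≟ v | adj B x v in xv
      ... | yes x≡v | _ = inj₁ x≡v
      ... | no _ | true = inj₂ (inj₁ refl)
      ... | no x≢v | false = inj₂ (inj₂ (x≢v , refl , adj-shift xv (flip-adj uv)))
      value : ∀ {x} → Code x → Fin (suc e)
      value (inj₁ _) = zero
      value (inj₂ (inj₁ xv)) = suc (edgeIndex xv)
      value (inj₂ (inj₂ (_ , _ , xu))) = suc (edgeIndex xu)
      f : Fin N → Fin (suc e)
      f x = value (code x)
      f-injective : ∀ x y (p : Code x) (q : Code y) → value p ≡ value q → x ≡ y
      f-injective x y (inj₁ refl) (inj₁ refl) _ = refl
      f-injective x y (inj₁ _) (inj₂ (inj₁ _)) ()
      f-injective x y (inj₁ _) (inj₂ (inj₂ _)) ()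
      f-injective x y (inj₂ (inj₁ _)) (inj₁ _) ()
      f-injective x y (inj₂ (inj₂ _)) (inj₁ _) ()
      f-injective x y (inj₂ (inj₁ p)) (inj₂ (inj₁ q)) eq with edgeIndex-injective p q (suc-injective eq)
      ... | inj₁ (x≡y , _) = x≡y
      ... | inj₂ (x≡v , v≡y) = trans x≡v v≡y
      f-injective x y (inj₂ (inj₂ (_ , _ , p))) (inj₂ (inj₂ (_ , _ , q))) eq
        with edgeIndex-injective p q (suc-injective eq)
      ... | inj₁ (x≡y , _) = x≡y
      ... | inj₂ (x≡u , u≡y) = trans x≡u u≡y
      f-injective x y (inj₂ (inj₁ p)) (inj₂ (inj₂ (y≢v , _ , q))) eq
        with edgeIndex-injective p q (suc-injective eq)
      ... | inj₁ (_ , v≡u) = contradiction (sym v≡u) (adj⇒≢ uv)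
      ... | inj₂ (_ , v≡y) = contradiction (sym v≡y) y≢v
      f-injective x y (inj₂ (inj₂ (x≢v , _ , p))) (inj₂ (inj₁ q)) eq
        with edgeIndex-injective p q (suc-injective eq)
      ... | inj₁ (_ , u≡v) = contradiction u≡v (adj⇒≢ uv)
      ... | inj₂ (x≡v , _) = contradiction x≡v x≢v

    -- By `order≤1+size`, `7 ≤ N` forces e to be at least 6, so a vertex of B has six neighbours in
    -- W; one inside B is the seventh.
    spread-nonempty : 7 ≤ N → e ≤ c → Spread (J c)
    spread-nonempty 7≤N e≤c (inj₂ w) = inj₂ (dense-W 7≤N w)
    spread-nonempty {c} 7≤N e≤c (inj₁ x) = inj₂ (g , g-injective , g-adj)
      where
      6≤c : 6 ≤ c
      6≤c = ≤-trans (s≤s⁻¹ (≤-trans 7≤N order≤1+size)) e≤c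
      g : Fin 7 → Fin N ⊎ Fin c
      g zero = inj₁ (proj₁ (neighbour x))
      g (suc i) = inj₂ (inject≤ i 6≤c)
      g-injective : Injective _≡_ _≡_ g
      g-injective {zero} {zero} _ = refl
      g-injective {suc i} {suc j} eq = cong suc (inject≤-injective 6≤c 6≤c i j (inj₂-injective eq))
      g-adj : ∀ i → joinEdge (inj₁ x) (g i) ≡ true
      g-adj zero = proj₂ (neighbour x)
      g-adj (suc i) = refl

    -- W is carried onto a part of B with c ≥ e vertices; two vertices of B outside that part
    -- would give more than c edges.
    module MovedPart (e≤c : e ≤ c) (φ : (Fin N ⊎ Fin c) ↔ (Fin N ⊎ Fin c))
                     (edge≡ : ∀ x y → joinEdge x y ≡ joinEdge (to φ x) (to φ y))
                     {w₀ : Fin c} {x₀ : Fin N} (moved : to φ (inj₂ w₀) ≡ inj₁ x₀) where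

      -- The image is nonadjacent to `x₀`, whereas every vertex of W is adjacent to `x₀`; so the
      -- image lies in B.
      part : ∀ w → ∃ λ x → to φ (inj₂ w) ≡ inj₁ x × adj B x x₀ ≡ false
      part w with to φ (inj₂ w) | edge≡ (inj₂ w) (inj₂ w₀)
      ... | x | eq rewrite moved with x
      ... | inj₁ x = x , refl , sym eq

      h : Fin N
      h = proj₁ (neighbour x₀)

      x₀h : adj B x₀ h ≡ true
      x₀h = proj₂ (neighbour x₀)

      nonadj-x₀ : ∀ x → x ≢ h → adj B x x₀ ≡ false
      nonadj-x₀ x x≢h with adj B x x₀ in xx₀
      ... | false = refl
      ... | true = contradiction (≤-trans (injective⇒≤ f-injective) e≤c) 1+n≰n
        where
        spoke : ∀ w → adj B (proj₁ (part w)) h ≡ true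
        spoke w = adj-shift (proj₂ (proj₂ (part w))) x₀h
        -- The images of W give c edges at `h`; the edge from `x` to `x₀` misses `h` and is one
        -- more, against `e ≤ c`.
        f : Fin (suc c) → Fin e
        f zero = edgeIndex xx₀
        f (suc w) = edgeIndex (spoke w)
        h≢x₀ : h ≢ x₀
        h≢x₀ = ≢-sym (adj⇒≢ x₀h)
        rest : ∀ w → f zero ≢ f (suc w)
        rest w eq with edgeIndex-injective xx₀ (spoke w) eq
        ... | inj₁ (_ , x₀≡h) = h≢x₀ (sym x₀≡h)
        ... | inj₂ (x≡h , _) = x≢h x≡h
        f-injective : Injective _≡_ _≡_ f
        f-injective {zero} {zero} _ = refl
        f-injective {zero} {suc w} eq = contradiction eq (rest w)
        f-injective {suc w} {zero} eq = contradiction (sym eq) (rest w)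
        f-injective {suc w} {suc w′} eq with edgeIndex-injective (spoke w) (spoke w′) eq
        ... | inj₁ (x≡ , _) = cong suc (inj₂-injective (to-injective φ
                (trans (proj₁ (proj₂ (part w))) (trans (cong inj₁ x≡) (sym (proj₁ (proj₂ (part w′))))))))
        ... | inj₂ (x≡h , _) = contradiction x≡h (adj⇒≢ (spoke w))

      hub : ∀ x → x ≢ h → adj B x h ≡ true
      hub x x≢h = adj-shift (nonadj-x₀ x x≢h) x₀h

      independent : ∀ x y → x ≢ h → y ≢ h → adj B x y ≡ false
      independent x y x≢h y≢h = nonadj-trans (nonadj-x₀ x x≢h) (flip-adj (nonadj-x₀ y y≢h))

  -- Packings in joins with independent sets of different sizes

  preserves-W : (φ : (Fin N ⊎ Fin c) ↔ (Fin N ⊎ Fin c)) →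
    (∀ x y → joinEdge x y ≡ joinEdge (to φ x) (to φ y)) →
    ∀ {w₀ w₁} → to φ (inj₂ w₀) ≡ inj₂ w₁ →
    Σ (Permutation′ N) λ β → Σ (Permutation′ c) λ ω →
      (∀ x → to φ (inj₁ x) ≡ inj₁ (to β x)) × (∀ w → to φ (inj₂ w) ≡ inj₂ (to ω w))
  preserves-W φ edge≡ {w₀} fixed = split-↔ φ B↦B W↦W
    where
    B↦B : ∀ x → ∃ λ y → to φ (inj₁ x) ≡ inj₁ y
    -- The image `inj₂ w₁` of `inj₂ w₀` is adjacent to all of B and to nothing in W, so it tells the
    -- two sides apart.
    B↦B x with to φ (inj₁ x) | edge≡ (inj₁ x) (inj₂ w₀)
    ... | y | eq rewrite fixed with y
    ... | inj₁ y = y , refl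
    W↦W : ∀ w → ∃ λ v → to φ (inj₂ w) ≡ inj₂ v
    W↦W w with to φ (inj₂ w) | edge≡ (inj₂ w) (inj₂ w₀)
    ... | y | eq rewrite fixed with y
    ... | inj₂ y = y , refl

  -- `ω` permutes `Fin c` and has no direct meaning on `Fin d`. The triangles see only its action
  -- among the first e positions; this partial injection is extended to a permutation of `Fin d`.
  transport-split : ∀ (e≤c : e ≤ c) (e≤d : e ≤ d) {S : Triangles (J e) k} {S′ : Triangles (J e) l} →
    (C : Carry (J c) (embed e≤c S) (embed e≤c S′)) (β : Permutation′ N) (ω : Permutation′ c) →
    (∀ x → to (Resolve.Carry.auto C) (inj₁ x) ≡ inj₁ (to β x)) →
    (∀ w → to (Resolve.Carry.auto C) (inj₂ w) ≡ inj₂ (to ω w)) →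
    Carry (J d) (embed e≤d S) (embed e≤d S′)
  transport-split {c} {d} e≤c e≤d {S} {S′} C β ω on-B on-W = record
    { index = index ; auto = Ψ ; edge≡ = edge≡′ ; mem⇒ = mem⇒′ ; mem⇐ = λ {i} {u} → mem⇐′ i u }
    where
    open Resolve.Carry C
    ιc : Fin e → Fin c
    ιc w = inject≤ w e≤c
    ιd : Fin e → Fin d
    ιd w = inject≤ w e≤d
    ιc-injective : ∀ {w v} → ιc w ≡ ιc v → w ≡ v
    ιc-injective = inject≤-injective e≤c e≤c _ _
    ιd-injective : ∀ {w v} → ιd w ≡ ιd v → w ≡ v
    ιd-injective = inject≤-injective e≤d e≤d _ _
    Goes : Fin d → Fin d → Set
    Goes x y = ∃₂ λ w v → (ιd w ≡ x × ιd v ≡ y) × to ω (ιc w) ≡ ιc v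
    extension = extend-to-permutation Goes
      (λ x y → any? λ w → any? λ v → ((ιd w ≟ x) ×-dec (ιd v ≟ y)) ×-dec (to ω (ιc w) ≟ ιc v))
      (λ { (w , v , (refl , refl) , p) (w′ , v′ , (eq , refl) , q) →
             cong ιd (ιc-injective (trans (sym p) (trans (cong (to ω ∘ ιc) (sym (ιd-injective eq))) q))) })
      (λ { (w , v , (refl , refl) , p) (w′ , v′ , (refl , eq) , q) →
             cong ιd (ιc-injective (to-injective ω (trans p (trans (cong ιc (sym (ιd-injective eq))) (sym q))))) })
    π = proj₁ extension
    Ψ : (Fin N ⊎ Fin d) ↔ (Fin N ⊎ Fin d)
    Ψ = β ⊎-↔ π
    edge≡′ : ∀ x y → joinEdge x y ≡ joinEdge (to Ψ x) (to Ψ y)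
    edge≡′ (inj₁ x) (inj₁ y) = trans (edge≡ (inj₁ x) (inj₁ y)) (cong₂ joinEdge (on-B x) (on-B y))
    edge≡′ (inj₁ _) (inj₂ _) = refl
    edge≡′ (inj₂ _) (inj₁ _) = refl
    edge≡′ (inj₂ _) (inj₂ _) = refl
    push : ∀ i s → s ∈ᵗ S i → to Ψ (emb e≤d s) ∈ᵗ embed e≤d S′ (to index i)
    push i s s∈ with mem⇒ {i} (∈ᵗ-map (emb e≤c) s∈)
    push i (inj₁ x) s∈ | j , eq = j , lower (S′ (to index i) j) (trans eq (on-B x))
      where
      lower : ∀ s′ → emb e≤c s′ ≡ inj₁ (to β x) → emb e≤d s′ ≡ inj₁ (to β x)
      lower (inj₁ y) refl = refl
    push i (inj₂ w) s∈ | j , eq = j , lower (S′ (to index i) j) (trans eq (on-W (ιc w)))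
      where
      lower : ∀ s′ → emb e≤c s′ ≡ inj₂ (to ω (ιc w)) → emb e≤d s′ ≡ inj₂ (to π (ιd w))
      lower (inj₂ v) eq = cong inj₂ (sym (proj₂ extension
        (w , v , (refl , refl) , sym (inj₂-injective eq))))
    mem⇒′ : ∀ {i x} → x ∈ᵗ embed e≤d S i → to Ψ x ∈ᵗ embed e≤d S′ (to index i)
    mem⇒′ {i} (j , refl) = push i (S i j) (j , refl)
    mem⇐′ : ∀ i x → to Ψ x ∈ᵗ embed e≤d S′ (to index i) → x ∈ᵗ embed e≤d S i
    mem⇐′ i x (j , eq) = pull (S′ (to index i) j) refl x eq
      where
      back : ∀ {s′ u} → S′ (to index i) j ≡ s′ → to auto u ≡ emb e≤c s′ → u ∈ᵗ embed e≤c S i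
      back eq eq′ = mem⇐ (j , trans (cong (emb e≤c) eq) (sym eq′))
      lowerB : ∀ {x} s → emb e≤c s ≡ inj₁ x → emb e≤d s ≡ inj₁ x
      lowerB (inj₁ _) refl = refl
      lowerW : ∀ {v y} s → emb e≤c s ≡ inj₂ (from ω (ιc v)) → ιd v ≡ to π y → emb e≤d s ≡ inj₂ y
      lowerW {v} (inj₂ w) eq eq′ = cong inj₂ (to-injective π (trans (proj₂ extension
        (w , v , (refl , refl) , from≡⇒to≡ ω (sym (inj₂-injective eq)))) eq′))
      pull : ∀ s′ → S′ (to index i) j ≡ s′ → ∀ x → emb e≤d s′ ≡ to Ψ x → x ∈ᵗ embed e≤d S i
      pull (inj₁ y) at (inj₁ x) eq with back at (trans (on-B x) (cong inj₁ (sym (inj₁-injective eq))))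
      ... | p , eq′ = p , lowerB (S i p) eq′
      -- The preimage of `ιc v` under `ω` is a corner of a triangle, so it lies among the first e
      -- positions, where `π` imitates `ω`.
      pull (inj₂ v) at (inj₂ y) eq
        with back at (trans (on-W (from ω (ιc v))) (cong inj₂ (strictlyInverseˡ ω (ιc v))))
      ... | p , eq′ = p , lowerW (S i p) eq′ (inj₂-injective eq)

  -- Without edges in B there are no triangles. Otherwise either W is preserved and the automorphism
  -- is transferred, or B is a star and equal numbers of triangles suffice.
  transport : (∀ {x y z} → adj B x y ≡ false → adj B y z ≡ false → adj B x z ≡ false) →
    ∀ (e≤c : e ≤ c) (e≤d : e ≤ d) {S : Triangles (J e) k} {S′ : Triangles (J e) l} →
    Packing (J e) S → Packing (J e) S′ →
    Carry (J c) (embed e≤c S) (embed e≤c S′) → Carry (J d) (embed e≤d S) (embed e≤d S′)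
  transport nonadj-trans e≤c e≤d {S} {S′} P P′ C
    with any? (λ x → any? (λ y → adj B x y Data.Bool.≟ true))
  ... | no edgeless = record
    { index = index ; auto = ↔-refl ; edge≡ = λ _ _ → refl
    ; mem⇒ = λ {i} _ → ⊥-elim (no-triangle i)
    ; mem⇐ = λ {i} _ → ⊥-elim (no-triangle i)
    }
    where
    open Resolve.Carry C
    no-triangle : ∀ i → ⊥
    no-triangle i with x , y , xy , _ ← base-edge P i = edgeless (x , y , xy)
  -- An edge of B makes e positive, so its index provides a vertex of W whose image decides the
  -- case.
  ... | yes (u , v , uv) with to (Resolve.Carry.auto C) (inj₂ (inject≤ (edgeIndex uv) e≤c)) in eq
  ... | inj₂ _ with β , ω , on-B , on-W ← preserves-W (Resolve.Carry.auto C) (Resolve.Carry.edge≡ C) eq =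
    transport-split e≤c e≤d {S} {S′} C β ω on-B on-W
  ... | inj₁ _ = StarBase.star-carry h hub independent
    (Packing-embed e≤d P) (Packing-embed e≤d P′) (Resolve.Carry.index C)
    where open MovedPart nonadj-trans uv e≤c (Resolve.Carry.auto C) (Resolve.Carry.edge≡ C) eq

  -- Either c = 0 and the vertices of B are isolated, or W alone gives each of them seven
  -- neighbours.
  spread-empty : (∀ x y → adj B x y ≡ false) → 7 ≤ N → ¬ Fin c ⊎ 7 ≤ c → Spread (J c)
  spread-empty none 7≤N _ (inj₂ w) = inj₂ (dense-W 7≤N w)
  spread-empty none _ (inj₁ ¬c) (inj₁ x) = inj₁ λ where
    (inj₁ y) → none x y
    (inj₂ w) → contradiction w ¬c
  spread-empty none _ (inj₂ 7≤c) (inj₁ x) = inj₂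
    ( (λ i → inj₂ (inject≤ i 7≤c))
    , (λ eq → inject≤-injective 7≤c 7≤c _ _ (inj₂-injective eq)) , λ _ → refl )

  -- Cousins on the two sides correspond when they come from the same packing in `J e`. Both `c` and
  -- `d` are left general so that the two directions of the theorem are instances.
  family-size : (∀ {x y z} → adj B x y ≡ false → adj B y z ≡ false → adj B x z ≡ false) →
    {G G′ : Graph} → e ≤ c → e ≤ d → Spread (J c) → Spread (J d) →
    Resolve.Unresolved (J c) G → Resolve.Unresolved (J d) G′ →
    ∀ {m} → HasFamilySize G m → HasFamilySize G′ m
  family-size {c} {d} nonadj-trans {G} {G′} e≤c e≤d spread-c spread-d unres-c unres-d =
    transfer-family-size Related total total′
      (λ (k , S , P , M , M′) (l , S₁ , P₁ , M₁ , M₁′) iso → Resolve.carry⇒≅ (J d) M′ M₁′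
        (transport nonadj-trans e≤c e≤d P P₁ (Resolve.≅⇒carry (J c) spread-c
          (Packing-embed e≤c P) (Packing-embed e≤c P₁) M M₁ iso)))
      (λ (k , S , P , M , M′) (l , S₁ , P₁ , M₁ , M₁′) iso → Resolve.carry⇒≅ (J c) M M₁
        (transport nonadj-trans e≤d e≤c P P₁ (Resolve.≅⇒carry (J d) spread-d
          (Packing-embed e≤d P) (Packing-embed e≤d P₁) M′ M₁′ iso)))
    where
    Related : Graph → Graph → Set
    Related H H′ = ∃₂ λ k (S : Triangles (J e) k) → Packing (J e) S ×
      Resolve.Models (J c) (embed e≤c S) H × Resolve.Models (J d) (embed e≤d S) H′
    normal : ∀ {c G} (e≤c : e ≤ c) → Spread (J c) → Resolve.Unresolved (J c) G → ∀ H → Cousin G H →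
             ∃₂ λ k (S : Triangles (J e) k) → Packing (J e) S × Resolve.Models (J c) (embed e≤c S) H
    normal {c} e≤c spread unres H cousin
      with k , T , P , M ← Resolve.Cousin-resolved (J c) spread
             (0 , (λ ()) , record { clique = λ () ; disjoint = λ { {()} } } , unres) cousin
      with S , P′ , C ← normalise e≤c P
      = k , S , P′ , Resolve.Models-carry (J c) C M
    total : ∀ H → Cousin G H → ∃ λ H′ → Cousin G′ H′ × Related H H′
    total H cousin
      with k , S , P , M ← normal e≤c spread-c unres-c H cousin
      with H′ , moves , M′ ← Resolve.realise (J d) unres-d (embed e≤d S) (Packing-embed e≤d P)
      = H′ , (H′ , moves , ≅-refl H′) , k , S , P , M , M′
    total′ : ∀ H′ → Cousin G′ H′ → ∃ λ H → Cousin G H × Related H H′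
    total′ H′ cousin
      with k , S , P , M′ ← normal e≤d spread-d unres-d H′ cousin
      with H , moves , M ← Resolve.realise (J c) unres-c (embed e≤c S) (Packing-embed e≤c P)
      = H , (H , moves , ≅-refl H) , k , S , P , M , M′

-- Complete multipartite graphs

<ᵇ-true : ∀ {i j} → i < j → (i <ᵇ j) ≡ true
<ᵇ-true i<j = Equivalence.to T-≡ (<⇒<ᵇ i<j)

<ᵇ-false : ∀ {i j} → ¬ i < j → (i <ᵇ j) ≡ false
<ᵇ-false {i} {j} i≮j = ¬-not λ eq → i≮j (<ᵇ⇒< i j (Equivalence.from T-≡ eq))

≡ᵇ-false : ∀ {i j} → i ≢ j → (i ≡ᵇ j) ≡ false
≡ᵇ-false {i} {j} i≢j = ¬-not λ eq → i≢j (≡ᵇ⇒≡ i j (Equivalence.from T-≡ eq))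

∸-<-sum : ∀ b bs {i} → i < sum (b ∷ bs) → (i <ᵇ b) ≡ false → i ∸ b < sum bs
∸-<-sum b bs {i} i<s eq = subst (i ∸ b <_) (m+n∸m≡n b (sum bs))
  (∸-monoˡ-< {n = b} i<s (≮⇒≥ λ i<b → true≢false (trans (sym (<ᵇ-true i<b)) eq)))

partOf-< : ∀ bs {i} → i < sum bs → partOf bs i < length bs
partOf-< (b ∷ bs) {i} i<s with i <ᵇ b in eq
... | true = s≤s z≤n
... | false = s≤s (partOf-< bs (∸-<-sum b bs i<s eq))

partOf-++ˡ : ∀ bs a {i} → i < sum bs → partOf (bs ++ [ a ]) i ≡ partOf bs i
partOf-++ˡ (b ∷ bs) a {i} i<s with i <ᵇ b in eq
... | true = refl
... | false = cong suc (partOf-++ˡ bs a (∸-<-sum b bs i<s eq))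

partOf-++ʳ : ∀ bs {a j} → j < a → partOf (bs ++ [ a ]) (sum bs + j) ≡ length bs
partOf-++ʳ [] j<a rewrite <ᵇ-true j<a = refl
partOf-++ʳ (b ∷ bs) {a} {j} j<a
  rewrite +-assoc b (sum bs) j | <ᵇ-false (m+n≮m b (sum bs + j)) | m+n∸m≡n b (sum bs + j)
  = cong suc (partOf-++ʳ bs j<a)

module Multipartite (bs : List ℕ) where
  open Join (KOn bs)

  part : Fin (sum bs) → ℕ
  part x = partOf bs (toℕ x)

  nonadj⇒part≡ : ∀ {x y} → adj (KOn bs) x y ≡ false → part x ≡ part y
  nonadj⇒part≡ {x} {y} eq = ≡ᵇ⇒≡ (part x) (part y) (Equivalence.from T-≡ (not-injective eq))

  part≡⇒nonadj : ∀ {x y} → part x ≡ part y → adj (KOn bs) x y ≡ false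
  part≡⇒nonadj {x} eq =
    trans (cong (λ q → not (part x ≡ᵇ q)) (sym eq)) (GraphOn.adj-irr (KOn bs) x)

  nonadj-trans : ∀ {x y z} → adj (KOn bs) x y ≡ false → adj (KOn bs) y z ≡ false →
                 adj (KOn bs) x z ≡ false
  nonadj-trans {x} {y} {z} xy yz =
    part≡⇒nonadj {x} {z} (trans (nonadj⇒part≡ {x} {y} xy) (nonadj⇒part≡ {y} {z} yz))

  join-unresolved : ∀ a → Resolve.Unresolved (J a) (K (bs ++ [ a ]))
  join-unresolved a = Resolve.unresolved (J a) χ same
    where
    sum≡ : sum bs + a ≡ sum (bs ++ [ a ])
    sum≡ = trans (cong (sum bs +_) (sym (+-identityʳ a))) (sym (sum-++ bs [ a ]))
    χ : (Fin (sum bs) ⊎ Fin a) ↔ Fin (sum (bs ++ [ a ]))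
    χ = ↔-trans (↔-sym +↔⊎) (cast-id sum≡)
    part-B : ∀ x → partOf (bs ++ [ a ]) (toℕ (to χ (inj₁ x))) ≡ part x
    part-B x rewrite toℕ-cast sum≡ (x Data.Fin.↑ˡ a) | toℕ-↑ˡ x a = partOf-++ˡ bs a (toℕ<n x)
    part-W : ∀ w → partOf (bs ++ [ a ]) (toℕ (to χ (inj₂ w))) ≡ length bs
    part-W w rewrite toℕ-cast sum≡ (sum bs Data.Fin.↑ʳ w) | toℕ-↑ʳ (sum bs) w = partOf-++ʳ bs (toℕ<n w)
    part≢ : ∀ x → part x ≢ length bs
    part≢ x eq = <-irrefl eq (partOf-< bs (toℕ<n x))
    same : ∀ u v → adj (KOn (bs ++ [ a ])) (to χ u) (to χ v) ≡ joinEdge u v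
    same (inj₁ x) (inj₁ y) = cong₂ (λ p q → not (p ≡ᵇ q)) (part-B x) (part-B y)
    same (inj₁ x) (inj₂ w) = trans (cong₂ (λ p q → not (p ≡ᵇ q)) (part-B x) (part-W w))
      (cong not (≡ᵇ-false (part≢ x)))
    same (inj₂ w) (inj₁ x) = trans (cong₂ (λ p q → not (p ≡ᵇ q)) (part-W w) (part-B x))
      (cong not (≡ᵇ-false (≢-sym (part≢ x))))
    same (inj₂ w) (inj₂ v) = trans (cong₂ (λ p q → not (p ≡ᵇ q)) (part-W w) (part-W v))
      (cong not (Equivalence.to T-≡ (≡⇒≡ᵇ (length bs) (length bs) refl)))

one-part-edgeless : ∀ b x y → adj (KOn (b ∷ [])) x y ≡ false
one-part-edgeless b x y = Multipartite.part≡⇒nonadj (b ∷ []) {x} {y} (trans (first x) (sym (first y)))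
  where
  first : ∀ x → Multipartite.part (b ∷ []) x ≡ 0
  first x rewrite <ᵇ-true (subst (toℕ x <_) (+-identityʳ b) (toℕ<n x)) = refl

two-parts-edge : ∀ b b′ bs → 1 ≤ b → 1 ≤ b′ → ∃₂ λ x y → adj (KOn (b ∷ b′ ∷ bs)) x y ≡ true
two-parts-edge (suc b) (suc b′) bs _ _ =
  -- `suc b` is the number of the first vertex of the second part.
  zero , fromℕ< in-range , adj-first (fromℕ< in-range) (toℕ-fromℕ< in-range)
  where
  in-range : suc b < suc b + (suc b′ + sum bs)
  in-range = m<m+n (suc b) (s≤s z≤n)
  adj-first : ∀ y → toℕ y ≡ suc b → adj (KOn (suc b ∷ suc b′ ∷ bs)) zero y ≡ true
  adj-first y eq rewrite eq | <ᵇ-false (<-irrefl {b} refl) = refl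

spread : ∀ bs aₙ → 1 ≤ length bs → All (λ x → 1 ≤ x) (bs ++ [ aₙ ]) → Linked _≤_ (bs ++ [ aₙ ]) →
         sum bs > 6 → numEdges (K bs) ≤ aₙ →
         Resolve.Spread (Join.J (KOn bs) aₙ) × Resolve.Spread (Join.J (KOn bs) (numEdges (K bs)))
-- With a single part, e = 0. The ordering supplies `7 ≤ a`; in the other join W is empty, as an
-- element of `Fin e` would yield an edge.
spread (b ∷ []) a _ _ (b≤a ∷ _) 6<b _ =
    Join.spread-empty _ (one-part-edgeless b) 6<b (inj₂ (≤-trans (subst (6 <_) (+-identityʳ b) 6<b) b≤a))
  , Join.spread-empty _ (one-part-edgeless b) 6<b (inj₁ λ i →
      let x , y , xy = Edges.edgeAt (KOn (b ∷ [])) i in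
      true≢false (trans (sym xy) (one-part-edgeless b x y)))
spread (b ∷ b′ ∷ bs) a _ (1≤b ∷ 1≤b′ ∷ _) _ 6<s e≤a
  with u , v , uv ← two-parts-edge b b′ bs 1≤b 1≤b′ =
    Join.spread-nonempty B nonadj {u} {v} uv 6<s e≤a
  , Join.spread-nonempty B nonadj {u} {v} uv 6<s ≤-refl
  where
  B = KOn (b ∷ b′ ∷ bs)
  nonadj = λ {x} {y} {z} → Multipartite.nonadj-trans (b ∷ b′ ∷ bs) {x} {y} {z}

theorem1 : (bs : List ℕ) (aₙ : ℕ) →
    1 ≤ length bs →
    All (λ x → 1 ≤ x) (bs ++ [ aₙ ]) →
    Linked _≤_ (bs ++ [ aₙ ]) →
    sum bs > 6 →
    numEdges (K bs) ≤ aₙ →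
    (m : ℕ) → HasFamilySize (K (bs ++ [ aₙ ])) m ⇔ HasFamilySize (K (bs ++ [ numEdges (K bs) ])) m
theorem1 bs aₙ nonempty positive sorted big e≤a m
  with spread-a , spread-e ← spread bs aₙ nonempty positive sorted big e≤a =
  mk⇔ (family-size nonadj e≤a ≤-refl spread-a spread-e (join-unresolved aₙ) (join-unresolved e))
      (family-size nonadj ≤-refl e≤a spread-e spread-a (join-unresolved e) (join-unresolved aₙ))
  where
  open Join (KOn bs)
  open Multipartite bs
  nonadj : ∀ {x y z} → adj (KOn bs) x y ≡ false → adj (KOn bs) y z ≡ false → adj (KOn bs) x z ≡ false
  nonadj {x} {y} {z} = nonadj-trans {x} {y} {z}
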